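{- Fix an integer $d\ge 1$. Let $G$ be a graph on $n$ vertices which is the complement of a $c$-closed graph. Then the number of inclusion-maximal sets $S\subseteq V(G)$ such that $G[S]$ is $d$-degenerate is $O(n^{8d}\, \mathcal{D}_d(2dc))$.
   Context: Graphs are finite, simple and undirected. A graph $H$ is $c$-closed if any two non-adjacent vertices have at most $c-1$ common neighbors; $G$ is the complement of a $c$-closed graph iff for any two adjacent vertices $u,v$ of $G$ at most $c-1$ vertices of $G$ are adjacent to neither $u$ nor $v$ (excluding $u,v$). A graph is $d$-degenerate if every induced subgraph has a vertex of degree at most $d$ in that subgraph. $\mathcal{D}_d(N)$ denotes the maximum, over all graphs $H$ on $N$ vertices, of the number of inclusion-maximal sets $S\subseteq V(H)$ such that $H[S]$ is $d$-degenerate. -}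

module Defs where

open import Data.Bool using (Bool; true; false; _∧_; _∨_; not; if_then_else_)
open import Data.Nat using (ℕ; zero; suc; _≤_; _<_; _≤ᵇ_)
open import Data.Fin using (Fin; _≟_)
open import Relation.Nullary.Decidable using (⌊_⌋)
open import Data.List using (List; []; _∷_; _++_; map; allFin; foldr)
open import Data.Bool.ListAction using (all; any)
open import Data.Vec using (Vec; []; _∷_; lookup)
open import Data.Product using (Σ; _×_)
open import Relation.Binary.PropositionalEquality using (_≡_)

record Graph (n : ℕ) : Set where
  field
    adj    : Fin n → Fin n → Bool
    sym    : ∀ u v → adj u v ≡ adj v u
    irrefl : ∀ v → adj v v ≡ false
open Graph public

VSet : ℕ → Set
VSet n = Vec Bool n

_∈ᵇ_ : {n : ℕ} → Fin n → VSet n → Bool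
v ∈ᵇ S = lookup S v

countᵇ : {A : Set} → (A → Bool) → List A → ℕ
countᵇ p = foldr (λ x acc → if p x then suc acc else acc) 0

allSubsets : (n : ℕ) → List (VSet n)
allSubsets zero    = [] ∷ []
allSubsets (suc n) = map (false ∷_) (allSubsets n) ++ map (true ∷_) (allSubsets n)

_⊆ᵇ_ : {n : ℕ} → VSet n → VSet n → Bool
_⊆ᵇ_ {n} T S = all (λ v → not (v ∈ᵇ T) ∨ (v ∈ᵇ S)) (allFin n)

_≟ˢ_ : {n : ℕ} → VSet n → VSet n → Bool
S ≟ˢ T = (S ⊆ᵇ T) ∧ (T ⊆ᵇ S)

nonemptyᵇ : {n : ℕ} → VSet n → Bool
nonemptyᵇ {n} T = any (λ v → v ∈ᵇ T) (allFin n)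

degIn : {n : ℕ} → Graph n → VSet n → Fin n → ℕ
degIn {n} G T v = countᵇ (λ u → (u ∈ᵇ T) ∧ adj G v u) (allFin n)

isDegenerate : {n : ℕ} → ℕ → Graph n → VSet n → Bool
isDegenerate {n} d G S =
  all (λ T → not ((T ⊆ᵇ S) ∧ nonemptyᵇ T)
             ∨ any (λ v → (v ∈ᵇ T) ∧ (degIn G T v ≤ᵇ d)) (allFin n))
      (allSubsets n)

isMaxDegenerate : {n : ℕ} → ℕ → Graph n → VSet n → Bool
isMaxDegenerate {n} d G S =
  isDegenerate d G S
  ∧ all (λ T → not ((S ⊆ᵇ T) ∧ not (S ≟ˢ T)) ∨ not (isDegenerate d G T))
        (allSubsets n)

numMaxDegenerate : {n : ℕ} → ℕ → Graph n → ℕ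
numMaxDegenerate {n} d G = countᵇ (isMaxDegenerate d G) (allSubsets n)

IsDmax : ℕ → ℕ → ℕ → Set
IsDmax d N m = Σ (Graph N) (λ H → numMaxDegenerate d H ≡ m)
             × (∀ (H : Graph N) → numMaxDegenerate d H ≤ m)

-- G is the complement of a c-closed graph: for any two adjacent vertices u, v,
-- fewer than c (i.e. at most c-1) vertices w ∉ {u,v} are adjacent to neither u nor v.
CoClosed : {n : ℕ} → ℕ → Graph n → Set
CoClosed {n} c G =
  ∀ (u v : Fin n) → adj G u v ≡ true →
    countᵇ (λ w → not (adj G u w) ∧ not (adj G v w)
                  ∧ not ⌊ w ≟ u ⌋ ∧ not ⌊ w ≟ v ⌋) (allFin n) < c

{-# OPTIONS --safe #-}

-- Let S be a maximal d-degenerate set and M a matching in G[S] with m edges.  Each edge of M is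
-- adjacent to all but at most c-1 of the other vertices, so all of S outside M and a set of at most
-- m(c-1) exceptional vertices sends at least m edges to V(M); counting edges in the d-degenerate
-- graph G[S] bounds the number of these remaining vertices of S in terms of d and m.
--
-- If d ≥ 2 and S has a matching with 2d-1 edges, this leaves S inside a set U of at most
-- (2d-1)c + 6d vertices which is described by 8d-1 vertices of G; since S is maximal in G[U], there
-- are at most D_d(|U|) such S per choice of U, and |U| ≤ 2dc as soon as c ≥ 6d.  If the matching
-- number m of S satisfies d < m < 2d-1, the absence of augmenting paths leaves at most d remaining
-- vertices.  For d = 1 a matching with two edges leaves |U| ≤ 2c+3 and a description by 5 vertices;
-- three further vertices of U missed by S bring |U| down to 2c.
--
-- If m ≤ d, the absence of augmenting paths shows that S consists of a core of at most 3d vertices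
-- and an independent set I all of whose vertices have at most d neighbours in the core.  By
-- maximality, I is a maximal independent set among all vertices of that kind.  Unless I is the
-- greedy independent set, it is determined by an edge wv and a maximal independent set in the fewer
-- than c common non-neighbours of w and v; replacing vertices by cliques K_{d+1} bounds the number
-- of the latter by D_d((d+1)c) ≤ D_d(2dc).

module Submission where

open import Defs
open import Data.Bool using (Bool; true; false; _∧_; _∨_; not; if_then_else_; T) renaming (_≟_ to _≟ᵇ_)
open import Data.Bool.Properties using (¬-not; ∨-zeroʳ; ∨-identityʳ)
open import Data.Bool.ListAction using (all; any)
open import Data.Empty using (⊥; ⊥-elim)
open import Data.Fin using (Fin; zero; suc; toℕ; _≟_; combine; remQuot)
open import Data.Fin.Properties using (any?; all?; suc-injective; toℕ-injective; combine-injectiveʳ; combine-remQuot; remQuot-combine)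
open import Data.List using (List; []; _∷_; _++_; map; allFin; length; filter; cartesianProduct; cartesianProductWith; deduplicate)
import Data.List as List
open import Data.List.Properties using (length-++; length-map; length-tabulate; length-deduplicate; length-filter; filter-notAll)
open import Data.List.Membership.Propositional using (_∈_; _∉_; find; lose)
open import Data.List.Membership.Propositional.Properties using (∈-∃++; ∈-++⁺ˡ; ∈-++⁺ʳ; ∈-++⁻; ∈-map⁺; ∈-map⁻; ∈-filter⁺; ∈-filter⁻; ∈-allFin; ∈-insert; ∈-lookup; ∈-cartesianProduct⁺; ∈-cartesianProductWith⁺; ∈-cartesianProductWith⁻; ∈-deduplicate⁺; ∈-deduplicate⁻)
open import Data.List.Relation.Unary.All as All using (All; []; _∷_)
open import Data.List.Relation.Unary.Any as Any using (Any; here; there)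
open import Data.List.Relation.Unary.Any.Properties using (lookup-index)
open import Data.List.Relation.Unary.AllPairs using ([]; _∷_)
open import Data.List.Relation.Unary.Unique.Propositional using (Unique)
import Data.List.Relation.Unary.Unique.Propositional.Properties as Unique
open import Data.List.Relation.Unary.Unique.DecPropositional.Properties using (deduplicate-!)
open import Data.List.Relation.Unary.Unique.DecPropositional using (unique?)
open import Data.Nat using (ℕ; zero; suc; pred; _+_; _*_; _^_; _≤_; _<_; z≤n; s≤s; _≤?_; _<?_; _≤ᵇ_; >-nonZero) renaming (_≟_ to _≟ℕ_)
open import Data.Nat.Properties hiding (_≟_; suc-injective)
open import Data.Nat.Tactic.RingSolver using (solve-∀)
open import Data.Product using (Σ; ∃; ∃-syntax; _×_; _,_; proj₁; proj₂)
open import Data.Sum using (_⊎_; inj₁; inj₂; [_,_]′)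
import Data.Sum as Sum
open import Data.Unit using (⊤)
open import Data.Vec using ([]; _∷_; lookup; tabulate; _[_]≔_)
open import Data.Vec.Properties using (lookup∘tabulate; tabulate∘lookup; tabulate-cong; lookup∘update; lookup∘update′)
open import Function using (_∘_; id; case_of_)
open import Relation.Binary.PropositionalEquality as ≡ using (_≡_; _≢_; refl; trans; cong; cong₂; subst)
open import Relation.Nullary using (¬_; Dec; yes; no; contradiction)
open import Relation.Nullary.Decidable as Dec using (⌊_⌋; ¬?; _×-dec_; _→-dec_; decidable-stable)
open import Relation.Unary using (Decidable)

private
  variable
    A B : Set
    n : ℕ

-- Counting over lists

∧-true⁻ : ∀ {a b} → a ∧ b ≡ true → a ≡ true × b ≡ true
∧-true⁻ {true} {true} _ = refl , refl

∧-true⁺ : ∀ {a b} → a ≡ true → b ≡ true → a ∧ b ≡ true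
∧-true⁺ refl refl = refl

not-true⁻ : ∀ {a} → not a ≡ true → a ≡ false
not-true⁻ {false} _ = refl

implies-true⁻ : ∀ {a b} → not a ∨ b ≡ true → a ≡ true → b ≡ true
implies-true⁻ h refl = h

implies-true⁺ : ∀ {a b} → (a ≡ true → b ≡ true) → not a ∨ b ≡ true
implies-true⁺ {false} _ = refl
implies-true⁺ {true}  h = h refl

true≢false : ∀ {a} → a ≡ true → a ≢ false
true≢false refl ()

isYes⁺ : {P : Set} (P? : Dec P) → P → ⌊ P? ⌋ ≡ true
isYes⁺ (yes _) _ = refl
isYes⁺ (no ¬p) p = contradiction p ¬p

isYes⁻ : {P : Set} (P? : Dec P) → ⌊ P? ⌋ ≡ true → P
isYes⁻ (yes p) _ = p

all-true⁻ : (p : A → Bool) {x : A} (xs : List A) → all p xs ≡ true → x ∈ xs → p x ≡ true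
all-true⁻ p (_ ∷ xs) h (here refl) = proj₁ (∧-true⁻ h)
all-true⁻ p (_ ∷ xs) h (there x∈)  = all-true⁻ p xs (proj₂ (∧-true⁻ h)) x∈

all-true⁺ : (p : A → Bool) (xs : List A) → (∀ {x} → x ∈ xs → p x ≡ true) → all p xs ≡ true
all-true⁺ p []       h = refl
all-true⁺ p (x ∷ xs) h = ∧-true⁺ (h (here refl)) (all-true⁺ p xs (h ∘ there))

any-true⁻ : (p : A → Bool) (xs : List A) → any p xs ≡ true → ∃[ x ] x ∈ xs × p x ≡ true
any-true⁻ p (x ∷ xs) h with p x in eq
... | true  = x , here refl , eq
... | false = let y , y∈ , py = any-true⁻ p xs h in y , there y∈ , py

any-true⁺ : (p : A → Bool) {x : A} (xs : List A) → x ∈ xs → p x ≡ true → any p xs ≡ true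
any-true⁺ p (x ∷ xs) (here refl) px rewrite px = refl
any-true⁺ p (x ∷ xs) (there x∈)  px with p x
... | true  = refl
... | false = any-true⁺ p xs x∈ px

count-++ : (p : A → Bool) (xs ys : List A) → countᵇ p (xs ++ ys) ≡ countᵇ p xs + countᵇ p ys
count-++ p []       ys = refl
count-++ p (x ∷ xs) ys with p x
... | true  = cong suc (count-++ p xs ys)
... | false = count-++ p xs ys

count-none : (p : A → Bool) (xs : List A) → (∀ {x} → x ∈ xs → p x ≡ false) → countᵇ p xs ≡ 0
count-none p []       h = refl
count-none p (x ∷ xs) h rewrite h (here refl) = count-none p xs (h ∘ there)

count-all : (p : A → Bool) (xs : List A) → (∀ {x} → x ∈ xs → p x ≡ true) → countᵇ p xs ≡ length xs
count-all p []       h = refl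
count-all p (x ∷ xs) h rewrite h (here refl) = cong suc (count-all p xs (h ∘ there))

select : (A → Bool) → List A → List A
select p []       = []
select p (x ∷ xs) = if p x then x ∷ select p xs else select p xs

length-select : (p : A → Bool) (xs : List A) → length (select p xs) ≡ countᵇ p xs
length-select p []       = refl
length-select p (x ∷ xs) with p x
... | true  = cong suc (length-select p xs)
... | false = length-select p xs

∈-select⁺ : (p : A → Bool) {x : A} (xs : List A) → x ∈ xs → p x ≡ true → x ∈ select p xs
∈-select⁺ p (x ∷ xs) (here refl) px rewrite px = here refl
∈-select⁺ p (y ∷ xs) (there x∈)  px with p y
... | true  = there (∈-select⁺ p xs x∈ px)
... | false = ∈-select⁺ p xs x∈ px

∈-select⁻ : (p : A → Bool) {x : A} (xs : List A) → x ∈ select p xs → x ∈ xs × p x ≡ true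
∈-select⁻ p (y ∷ xs) x∈ with p y in eq
∈-select⁻ p (y ∷ xs) (here refl) | true = here refl , eq
∈-select⁻ p (y ∷ xs) (there x∈)  | true =
  let x∈xs , px = ∈-select⁻ p xs x∈ in there x∈xs , px
∈-select⁻ p (y ∷ xs) x∈ | false = let x∈xs , px = ∈-select⁻ p xs x∈ in there x∈xs , px

unique-select : (p : A → Bool) {xs : List A} → Unique xs → Unique (select p xs)
unique-select p [] = []
unique-select p {x ∷ xs} (x∉ ∷ u) with p x
... | true  = All.tabulate (λ y∈ → All.lookup x∉ (proj₁ (∈-select⁻ p xs y∈))) ∷ unique-select p u
... | false = unique-select p u

∈-remove : ∀ {x y : A} as {bs} → x ∈ as ++ y ∷ bs → x ≢ y → x ∈ as ++ bs
∈-remove as x∈ x≢y with ∈-++⁻ as x∈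
... | inj₁ x∈as         = ∈-++⁺ˡ x∈as
... | inj₂ (here x≡y)   = contradiction x≡y x≢y
... | inj₂ (there x∈bs) = ∈-++⁺ʳ as x∈bs

length-insert : ∀ {x : A} as {bs} → length (as ++ x ∷ bs) ≡ suc (length (as ++ bs))
length-insert []       = refl
length-insert (_ ∷ as) = cong suc (length-insert as)

unique-head : ∀ {x : A} {xs} → Unique (x ∷ xs) → x ∉ xs
unique-head (x≢ ∷ _) x∈ = All.lookup x≢ x∈ refl

unique-cons : ∀ {x : A} {xs} → x ∉ xs → Unique xs → Unique (x ∷ xs)
unique-cons x∉ u = All.tabulate (λ { y∈ refl → x∉ y∈ }) ∷ u

unique-remove : ∀ (as : List A) {x bs} → Unique (as ++ x ∷ bs) → Unique (as ++ bs)
unique-remove []       (_ ∷ u)  = u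
unique-remove (a ∷ as) {x} {bs} (a≢ ∷ u) =
  All.tabulate (λ y∈ → All.lookup a≢ (widen y∈)) ∷ unique-remove as u
  where
  widen : ∀ {y} → y ∈ as ++ bs → y ∈ as ++ x ∷ bs
  widen y∈ = [ ∈-++⁺ˡ , ∈-++⁺ʳ as ∘ there ]′ (∈-++⁻ as y∈)

unique-length-≤ : {xs ys : List A} → Unique xs → (∀ {x} → x ∈ xs → x ∈ ys) → length xs ≤ length ys
unique-length-≤ {xs = []}     _        _   = z≤n
unique-length-≤ {xs = x ∷ xs} u@(_ ∷ u′) sub with ∈-∃++ (sub (here refl))
... | as , bs , refl rewrite length-insert {x = x} as {bs} =
  s≤s (unique-length-≤ u′ λ y∈ → ∈-remove as (sub (there y∈)) λ { refl → unique-head u y∈ })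

count-≤ : (p q : A → Bool) {xs ys : List A} → Unique xs →
          (∀ {x} → x ∈ xs → p x ≡ true → x ∈ ys × q x ≡ true) → countᵇ p xs ≤ countᵇ q ys
count-≤ p q {xs} {ys} u h = begin
  countᵇ p xs          ≡⟨ length-select p xs ⟨
  length (select p xs) ≤⟨ unique-length-≤ (unique-select p u) inc ⟩
  length (select q ys) ≡⟨ length-select q ys ⟩
  countᵇ q ys          ∎
  where
  open ≤-Reasoning
  inc : ∀ {x} → x ∈ select p xs → x ∈ select q ys
  inc x∈ = let x∈xs , px = ∈-select⁻ p xs x∈ ; x∈ys , qx = h x∈xs px in ∈-select⁺ q ys x∈ys qx

-- Every list of distinct elements of P has at most b entries: this bounds the size of P without
-- requiring P to be decidable.
Bounded : (A → Set) → ℕ → Set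
Bounded P b = ∀ xs → Unique xs → All P xs → length xs ≤ b

bounded-⊆ : {P Q : A → Set} {b : ℕ} → (∀ {x} → P x → Q x) → Bounded Q b → Bounded P b
bounded-⊆ f h xs u ps = h xs u (All.map f ps)

bounded-≤ : {P : A → Set} {a b : ℕ} → a ≤ b → Bounded P a → Bounded P b
bounded-≤ a≤b h xs u ps = ≤-trans (h xs u ps) a≤b

-- A nonempty list already carries a proof of `G`, and the empty list needs no bound. Facts such as
-- an adjacency or a length estimate can thus be stored with the counted objects and used in
-- counting them.
bounded-guard : {P : A → Set} {G : Set} {b : ℕ} → (G → Bounded P b) → Bounded (λ x → G × P x) b
bounded-guard h []       u ps = z≤n
bounded-guard h (x ∷ xs) u ps@((g , _) ∷ _) = h g (x ∷ xs) u (All.map proj₂ ps)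

bounded-subsingleton : {P : A → Set} → (∀ {x y} → P x → P y → x ≡ y) → Bounded P 1
bounded-subsingleton h []           u ps = z≤n
bounded-subsingleton h (x ∷ [])     u ps = s≤s z≤n
bounded-subsingleton h (x ∷ y ∷ xs) ((x≢y ∷ _) ∷ _) (px ∷ py ∷ _) = contradiction (h px py) x≢y

bounded-injection : {P : A → Set} {Q : B → Set} {b : ℕ} (f : A → B) → (∀ {x} → P x → Q (f x)) →
  (∀ {x y} → P x → P y → f x ≡ f y → x ≡ y) → Bounded Q b → Bounded P b
bounded-injection {P = P} {Q} f pres inj h xs u ps =
  subst (_≤ _) (length-map f xs) (h (map f xs) (unique xs u ps) (image xs ps))
  where
  image : ∀ xs → All P xs → All Q (map f xs)
  image []       []       = []
  image (x ∷ xs) (p ∷ ps) = pres p ∷ image xs ps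
  unique : ∀ xs → Unique xs → All P xs → Unique (map f xs)
  unique []       []       []       = []
  unique (x ∷ xs) u@(_ ∷ u′) (p ∷ ps) = unique-cons fresh (unique xs u′ ps)
    where
    fresh : f x ∉ map f xs
    fresh fx∈ with ∈-map⁻ f fx∈
    ... | y , y∈ , eq with refl ← inj p (All.lookup ps y∈) eq = unique-head u y∈

bounded-⊎ : {P Q : A → Set} {a b : ℕ} → Bounded P a → Bounded Q b →
            Bounded (λ x → P x ⊎ Q x) (a + b)
bounded-⊎ {A = A} {P} {Q} hP hQ xs u ps =
  let ls , rs , ul , ur , al , ar , _ , _ , eq = split xs u ps
  in subst (_≤ _) eq (+-mono-≤ (hP ls ul al) (hQ rs ur ar))
  where
  split : ∀ xs → Unique xs → All (λ x → P x ⊎ Q x) xs → ∃[ ls ] ∃[ rs ]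
    Unique ls × Unique rs × All P ls × All Q rs ×
    (∀ {x} → x ∈ ls → x ∈ xs) × (∀ {x} → x ∈ rs → x ∈ xs) × length ls + length rs ≡ length xs
  split [] [] [] = [] , [] , [] , [] , [] , [] , (λ ()) , (λ ()) , refl
  split (x ∷ xs) u@(_ ∷ u′) (p ∷ ps) with split xs u′ ps | p
  ... | ls , rs , ul , ur , al , ar , sl , sr , eq | inj₁ px =
    x ∷ ls , rs , unique-cons (unique-head u ∘ sl) ul , ur , px ∷ al , ar ,
    (λ { (here e) → here e ; (there y∈) → there (sl y∈) }) , there ∘ sr , cong suc eq
  ... | ls , rs , ul , ur , al , ar , sl , sr , eq | inj₂ qx =
    ls , x ∷ rs , ul , unique-cons (unique-head u ∘ sr) ur , al , qx ∷ ar ,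
    there ∘ sl , (λ { (here e) → here e ; (there y∈) → there (sr y∈) }) ,
    trans (+-suc _ _) (cong suc eq)

-- The union bound behind the counts below: `ks` lists the possible codes, and an element may have
-- several of them.
bounded-∃ : {K : Set} {Q : K → A → Set} {b : ℕ} (ks : List K) → (∀ k → Bounded (Q k) b) →
            Bounded (λ x → ∃[ k ] k ∈ ks × Q k x) (length ks * b)
bounded-∃ [] h [] u ps = z≤n
bounded-∃ [] h (x ∷ xs) u ((_ , () , _) ∷ _)
bounded-∃ {Q = Q} (k ∷ ks) h = bounded-⊆ split (bounded-⊎ (h k) (bounded-∃ ks h))
  where
  split : ∀ {x} → ∃[ j ] j ∈ k ∷ ks × Q j x → Q k x ⊎ ∃[ j ] j ∈ ks × Q j x
  split (_ , here refl , q) = inj₁ q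
  split (j , there j∈ , q)  = inj₂ (j , j∈ , q)

-- Enumerating subsets and short words

∈-allSubsets : (S : VSet n) → S ∈ allSubsets n
∈-allSubsets []          = here refl
∈-allSubsets (false ∷ S) = ∈-++⁺ˡ (∈-map⁺ (false ∷_) (∈-allSubsets S))
∈-allSubsets (true ∷ S)  = ∈-++⁺ʳ (map (false ∷_) (allSubsets _)) (∈-map⁺ (true ∷_) (∈-allSubsets S))

unique-allSubsets : ∀ n → Unique (allSubsets n)
unique-allSubsets zero    = [] ∷ []
unique-allSubsets (suc n) = Unique.++⁺ (Unique.map⁺ (λ { refl → refl }) (unique-allSubsets n))
  (Unique.map⁺ (λ { refl → refl }) (unique-allSubsets n)) λ (x∈ , y∈) → disjoint x∈ y∈
  where
  disjoint : ∀ {S} → S ∈ map (false ∷_) (allSubsets n) → S ∈ map (true ∷_) (allSubsets n) → ⊥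
  disjoint x∈ y∈ with ∈-map⁻ (false ∷_) x∈ | ∈-map⁻ (true ∷_) y∈
  ... | _ , _ , refl | _ , _ , ()

length-allSubsets : ∀ n → length (allSubsets n) ≡ 2 ^ n
length-allSubsets zero    = refl
length-allSubsets (suc n) = trans (length-++ (map (false ∷_) (allSubsets n)))
  (cong₂ _+_ (trans (length-map _ (allSubsets n)) (length-allSubsets n))
             (trans (trans (length-map _ (allSubsets n)) (length-allSubsets n)) (≡.sym (+-identityʳ _))))

bounded-count : (p : VSet n → Bool) → Bounded (λ S → p S ≡ true) (countᵇ p (allSubsets n))
bounded-count p xs u ps = subst (length xs ≤_) (length-select p (allSubsets _))
  (unique-length-≤ u λ x∈ → ∈-select⁺ p (allSubsets _) (∈-allSubsets _) (All.lookup ps x∈))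

count-bounded : (p : VSet n → Bool) {b : ℕ} → Bounded (λ S → p S ≡ true) b →
                countᵇ p (allSubsets n) ≤ b
count-bounded p h = subst (_≤ _) (length-select p (allSubsets _))
  (h _ (unique-select p (unique-allSubsets _))
       (All.tabulate (proj₂ ∘ ∈-select⁻ p (allSubsets _))))

bounded-VSet : (P : VSet n → Set) → Bounded P (2 ^ n)
bounded-VSet {n} P xs u ps = subst (length xs ≤_) (length-allSubsets n)
  (unique-length-≤ u λ _ → ∈-allSubsets _)

wordsUpTo : List A → ℕ → List (List A)
wordsUpTo xs zero    = [] ∷ []
wordsUpTo xs (suc k) = [] ∷ cartesianProductWith _∷_ xs (wordsUpTo xs k)

length-cartesianProductWith : {C : Set} (f : A → B → C) (xs : List A) (ys : List B) →
  length (cartesianProductWith f xs ys) ≡ length xs * length ys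
length-cartesianProductWith f []       ys = refl
length-cartesianProductWith f (x ∷ xs) ys = trans (length-++ (map (f x) ys))
  (cong₂ _+_ (length-map (f x) ys) (length-cartesianProductWith f xs ys))

-- The extra 1 in the base pays for the word `[]` that each level adds, so descriptions of varying
-- length cost no more than a single power.
length-wordsUpTo : (xs : List A) (k : ℕ) → length (wordsUpTo xs k) ≤ suc (length xs) ^ k
length-wordsUpTo xs zero    = s≤s z≤n
length-wordsUpTo xs (suc k) = +-mono-≤ (m^n>0 (suc (length xs)) k)
  (≤-trans (≤-reflexive (length-cartesianProductWith _∷_ xs (wordsUpTo xs k)))
           (*-monoʳ-≤ (length xs) (length-wordsUpTo xs k)))

∈-wordsUpTo : {xs : List A} (w : List A) {k : ℕ} → length w ≤ k → (∀ {x} → x ∈ w → x ∈ xs) →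
              w ∈ wordsUpTo xs k
∈-wordsUpTo []      {zero}  _       _   = here refl
∈-wordsUpTo []      {suc k} _       _   = here refl
∈-wordsUpTo (x ∷ w) {suc k} (s≤s l) sub =
  there (∈-cartesianProductWith⁺ _∷_ (sub (here refl)) (∈-wordsUpTo w l (sub ∘ there)))

-- Degenerate sets

infix 4 _∈ₛ_ _∉ₛ_

-- A record rather than a synonym, so that S can be inferred from a membership proof.
record _∈ₛ_ (v : Fin n) (S : VSet n) : Set where
  constructor member
  field isMember : lookup S v ≡ true
open _∈ₛ_

_∉ₛ_ : Fin n → VSet n → Set
v ∉ₛ S = ¬ v ∈ₛ S

_∈ₛ?_ : (v : Fin n) (S : VSet n) → Dec (v ∈ₛ S)
v ∈ₛ? S = Dec.map′ member isMember (lookup S v ≟ᵇ true)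

insert : Fin n → VSet n → VSet n
insert x S = S [ x ]≔ true

∈-insert-self : (x : Fin n) (S : VSet n) → x ∈ₛ insert x S
∈-insert-self x S = member (lookup∘update x S true)

∈-insert⁺ : ∀ (x : Fin n) {y} (S : VSet n) → y ∈ₛ S → y ∈ₛ insert x S
∈-insert⁺ x {y} S y∈ with y ≟ x
... | yes refl = ∈-insert-self x S
... | no y≢x   = member (trans (lookup∘update′ y≢x S true) (isMember y∈))

∈-insert⁻ : ∀ {x y : Fin n} (S : VSet n) → y ∈ₛ insert x S → y ≢ x → y ∈ₛ S
∈-insert⁻ S y∈ y≢x = member (trans (≡.sym (lookup∘update′ y≢x S true)) (isMember y∈))

fromDec : {P : Fin n → Set} → Decidable P → VSet n
fromDec P? = tabulate λ x → ⌊ P? x ⌋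

∈-fromDec⁺ : {P : Fin n → Set} (P? : Decidable P) {x : Fin n} → P x → x ∈ₛ fromDec P?
∈-fromDec⁺ P? {x} p = member (trans (lookup∘tabulate _ x) (isYes⁺ (P? x) p))

∈-fromDec⁻ : {P : Fin n → Set} (P? : Decidable P) {x : Fin n} → x ∈ₛ fromDec P? → P x
∈-fromDec⁻ P? {x} x∈ = isYes⁻ (P? x) (trans (≡.sym (lookup∘tabulate _ x)) (isMember x∈))

VSet-ext : {S T : VSet n} → (∀ {x} → x ∈ₛ S → x ∈ₛ T) → (∀ {x} → x ∈ₛ T → x ∈ₛ S) → S ≡ T
VSet-ext {S = S} {T} st ts =
  trans (≡.sym (tabulate∘lookup S)) (trans (tabulate-cong same) (tabulate∘lookup T))
  where
  bool-ext : ∀ {a b} → (a ≡ true → b ≡ true) → (b ≡ true → a ≡ true) → a ≡ b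
  bool-ext {true}  {b}     f g = ≡.sym (f refl)
  bool-ext {false} {true}  f g = g refl
  bool-ext {false} {false} f g = refl
  same : ∀ x → lookup S x ≡ lookup T x
  same x = bool-ext (isMember ∘ st ∘ member) (isMember ∘ ts ∘ member)

_∈?_ : (x : Fin n) (xs : List (Fin n)) → Dec (x ∈ xs)
x ∈? xs = Any.any? (x ≟_) xs

-- Subsets of S are presented as duplicate-free lists, so that degrees are counts over a list.
record Degenerate (d : ℕ) (G : Graph n) (S : VSet n) : Set where
  constructor degen
  field
    lowDegree : ∀ l → Unique l → ∃ (_∈ l) → (∀ {x} → x ∈ l → x ∈ₛ S) →
                ∃[ v ] v ∈ l × countᵇ (adj G v) l ≤ d
open Degenerate

⊆ᵇ⁻ : {T S : VSet n} → (T ⊆ᵇ S) ≡ true → ∀ {x} → x ∈ₛ T → x ∈ₛ S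
⊆ᵇ⁻ {n} h {x} x∈ = member (implies-true⁻ (all-true⁻ _ (allFin n) h (∈-allFin x)) (isMember x∈))

⊆ᵇ⁺ : {T S : VSet n} → (∀ {x} → x ∈ₛ T → x ∈ₛ S) → (T ⊆ᵇ S) ≡ true
⊆ᵇ⁺ {n} h = all-true⁺ _ (allFin n) λ _ → implies-true⁺ (isMember ∘ h ∘ member)

≤ᵇ-true⁻ : ∀ {a b} → (a ≤ᵇ b) ≡ true → a ≤ b
≤ᵇ-true⁻ {a} {b} h = ≤ᵇ⇒≤ a b (subst T (≡.sym h) _)

≤ᵇ-true⁺ : ∀ {a b} → a ≤ b → (a ≤ᵇ b) ≡ true
≤ᵇ-true⁺ {a} {b} h with a ≤ᵇ b | ≤⇒≤ᵇ h
... | true | _ = refl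

isDegenerate⁻ : ∀ {d} {G : Graph n} {S} → isDegenerate d G S ≡ true → Degenerate d G S
isDegenerate⁻ {n} {d} {G} {S} h .lowDegree l u (x , x∈) sub
  with any-true⁻ _ (allFin n) (implies-true⁻ (all-true⁻ _ (allSubsets n) h (∈-allSubsets T′))
    (∧-true⁺ (⊆ᵇ⁺ {T = T′} {S} (sub ∘ ∈-fromDec⁻ (_∈? l)))
             (any-true⁺ _ (allFin n) (∈-allFin x) (isMember (∈-fromDec⁺ (_∈? l) x∈)))))
  where T′ = fromDec (_∈? l)
... | v , _ , hv = v , ∈-fromDec⁻ (_∈? l) (member (proj₁ (∧-true⁻ hv))) ,
  ≤-trans (count-≤ _ _ u λ y∈ vy → ∈-allFin _ , ∧-true⁺ (isMember (∈-fromDec⁺ (_∈? l) y∈)) vy)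
          (≤ᵇ-true⁻ (proj₂ (∧-true⁻ hv)))

isDegenerate⁺ : ∀ {d} {G : Graph n} {S} → Degenerate d G S → isDegenerate d G S ≡ true
isDegenerate⁺ {n} {d} {G} {S} deg = all-true⁺ _ (allSubsets n) λ {T′} _ → implies-true⁺ (check T′)
  where
  check : ∀ T′ → (T′ ⊆ᵇ S) ∧ nonemptyᵇ T′ ≡ true →
          any (λ v → (v ∈ᵇ T′) ∧ (degIn G T′ v ≤ᵇ d)) (allFin n) ≡ true
  check T′ h =
    let sub , ne = ∧-true⁻ h
        x , _ , x∈T = any-true⁻ _ (allFin n) ne
        l = select (lookup T′) (allFin n)
        v , v∈ , le = lowDegree deg l (unique-select _ (Unique.allFin⁺ n))
          (x , ∈-select⁺ _ (allFin n) (∈-allFin x) x∈T)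
          (λ y∈ → ⊆ᵇ⁻ {T = T′} {S} sub (member (proj₂ (∈-select⁻ _ (allFin n) y∈))))
    in any-true⁺ _ (allFin n) (∈-allFin v) (∧-true⁺ (proj₂ (∈-select⁻ _ (allFin n) v∈))
         (≤ᵇ-true⁺ (≤-trans (count-≤ _ _ (Unique.allFin⁺ n) λ _ h′ →
           let y∈T , vy = ∧-true⁻ h′ in ∈-select⁺ _ (allFin n) (∈-allFin _) y∈T , vy) le)))

degenerate-⊆ : ∀ {d} {G : Graph n} {S T} → (∀ {x} → x ∈ₛ S → x ∈ₛ T) →
               Degenerate d G T → Degenerate d G S
degenerate-⊆ st deg .lowDegree l u ne sub = lowDegree deg l u ne (st ∘ sub)

-- Maximality is tested by adding one vertex at a time; this agrees with inclusion-maximality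
-- because degeneracy passes to subsets. The list `U` is the ambient vertex set.
record MaximalIn (d : ℕ) (G : Graph n) (U : List (Fin n)) (S : VSet n) : Set where
  field
    inside     : ∀ {x} → x ∈ₛ S → x ∈ U
    degenerate : Degenerate d G S
    maximal    : ∀ {x} → x ∈ U → x ∉ₛ S → ¬ Degenerate d G (insert x S)
open MaximalIn

isMaxDegenerate⁻ : ∀ {d} {G : Graph n} {S} → isMaxDegenerate d G S ≡ true →
                   MaximalIn d G (allFin n) S
isMaxDegenerate⁻ {n} {d} {G} {S} h = record
  { inside     = λ _ → ∈-allFin _
  ; degenerate = isDegenerate⁻ (proj₁ (∧-true⁻ h))
  ; maximal    = λ {x} _ x∉ deg → true≢false (isDegenerate⁺ deg) (not-true⁻ (implies-true⁻
      (all-true⁻ _ (allSubsets n) (proj₂ (∧-true⁻ h)) (∈-allSubsets (insert x S)))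
      (proper x x∉)))
  }
  where
  proper : ∀ x → x ∉ₛ S → (S ⊆ᵇ insert x S) ∧ not (S ≟ˢ insert x S) ≡ true
  proper x x∉ = ∧-true⁺ (⊆ᵇ⁺ {T = S} {insert x S} (∈-insert⁺ x S)) (cong not
    (¬-not λ eq → x∉ (⊆ᵇ⁻ {T = insert x S} {S} (proj₂ (∧-true⁻ eq)) (∈-insert-self x S))))

isMaxDegenerate⁺ : ∀ {d} {G : Graph n} {S} → MaximalIn d G (allFin n) S →
                   isMaxDegenerate d G S ≡ true
isMaxDegenerate⁺ {n} {d} {G} {S} max = ∧-true⁺ (isDegenerate⁺ (degenerate max))
  (all-true⁺ _ (allSubsets n) λ {T′} _ → implies-true⁺ (check T′))
  where
  check : ∀ T′ → (S ⊆ᵇ T′) ∧ not (S ≟ˢ T′) ≡ true → not (isDegenerate d G T′) ≡ true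
  check T′ h = cong not (¬-not λ degT →
    let S⊆T , S≠T = ∧-true⁻ h
        -- A vertex `x` of a degenerate `T′` outside `S` would make `insert x S` a subset of `T′`,
        -- hence degenerate.
        sub : ∀ {x} → x ∈ₛ T′ → x ∈ₛ S
        sub {x} x∈T = decidable-stable (x ∈ₛ? S) λ x∉S → maximal max (∈-allFin x) x∉S
          (degenerate-⊆ {G = G} {T = T′} (grow x x∈T S⊆T) (isDegenerate⁻ degT))
    in true≢false (∧-true⁺ S⊆T (⊆ᵇ⁺ {T = T′} {S} sub)) (not-true⁻ S≠T))
    where
    grow : ∀ x → x ∈ₛ T′ → (S ⊆ᵇ T′) ≡ true → ∀ {y} → y ∈ₛ insert x S → y ∈ₛ T′
    grow x x∈T S⊆T {y} y∈ with y ≟ x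
    ... | yes refl = x∈T
    ... | no y≢x   = ⊆ᵇ⁻ {T = S} {T′} S⊆T (∈-insert⁻ S y∈ y≢x)

bounded-maximal : (d : ℕ) (G : Graph n) →
                  Bounded (MaximalIn d G (allFin n)) (numMaxDegenerate d G)
bounded-maximal d G = bounded-⊆ isMaxDegenerate⁺ (bounded-count (isMaxDegenerate d G))

numMax-bounded : ∀ {d b} {G : Graph n} → Bounded (MaximalIn d G (allFin n)) b →
                 numMaxDegenerate d G ≤ b
numMax-bounded h = count-bounded _ (bounded-⊆ isMaxDegenerate⁻ h)

-- Shrinking the ambient list around `S` only removes candidates for extension. This is how a small
-- set `U` containing `S` bounds the number of possible `S`.
maximalIn-restrict : ∀ {d} {G : Graph n} {U V S} → (∀ {x} → x ∈ U → x ∈ V) →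
  (∀ {x} → x ∈ₛ S → x ∈ U) → MaximalIn d G V S → MaximalIn d G U S
maximalIn-restrict U⊆V S⊆U max = record
  { inside = S⊆U ; degenerate = degenerate max ; maximal = maximal max ∘ U⊆V }

-- Transfer of degeneracy along graph embeddings

count-map : (f : A → B) {p : B → Bool} {q : A → Bool} → (∀ x → p (f x) ≡ q x) → ∀ xs →
            countᵇ p (map f xs) ≡ countᵇ q xs
count-map f h []       = refl
count-map f {p} {q} h (x ∷ xs) rewrite h x with q x
... | true  = cong suc (count-map f h xs)
... | false = count-map f h xs

module _ {a b : ℕ} {G : Graph a} {H : Graph b} (f : Fin a → Fin b)
         (f-adj : ∀ i j → adj H (f i) (f j) ≡ adj G i j) where

  degenerate-preimage : ∀ {d S T} → (∀ {i j} → f i ≡ f j → i ≡ j) →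
    (∀ {i} → i ∈ₛ S → f i ∈ₛ T) → Degenerate d H T → Degenerate d G S
  degenerate-preimage f-inj st deg .lowDegree l u (x , x∈) sub
    with lowDegree deg (map f l) (Unique.map⁺ f-inj u) (f x , ∈-map⁺ f x∈) imageT
    where
    imageT : ∀ {y} → y ∈ map f l → y ∈ₛ _
    imageT y∈ with _ , i∈ , refl ← ∈-map⁻ f y∈ = st (sub i∈)
  ... | _ , v∈ , le with v , v∈l , refl ← ∈-map⁻ f v∈ =
    v , v∈l , subst (_≤ _) (count-map f (f-adj v) l) le

  -- A list in `T` is pulled back entry by entry; distinctness of its entries forces that of the
  -- preimages, and `f-adj` preserves the degrees.
  degenerate-image : ∀ {d S T} → (∀ {y} → y ∈ₛ T → ∃[ i ] f i ≡ y × i ∈ₛ S) →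
    Degenerate d G S → Degenerate d H T
  degenerate-image {S = S} {T} ts deg .lowDegree l u ne sub with pull l sub
    where
    pull : ∀ l → (∀ {y} → y ∈ l → y ∈ₛ T) → ∃[ k ] map f k ≡ l × (∀ {i} → i ∈ k → i ∈ₛ S)
    pull []      _   = [] , refl , λ ()
    pull (y ∷ l) sub with ts (sub (here refl)) | pull l (sub ∘ there)
    ... | i , refl , i∈ | k , refl , k⊆ =
      i ∷ k , refl , λ { (here refl) → i∈ ; (there j∈) → k⊆ j∈ }
  ... | k , refl , k⊆ with i , i∈ , _ ← ∈-map⁻ f (proj₂ ne)
    with lowDegree deg k (Unique.map⁻ u) (i , i∈) k⊆
  ... | v , v∈ , le = f v , ∈-map⁺ f v∈ , subst (_≤ _) (≡.sym (count-map f (f-adj v) k)) le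

-- Induced subgraphs and padding by isolated vertices

induced : Graph n → (U : List (Fin n)) → Graph (length U)
induced G U = record
  { adj    = λ i j → adj G (List.lookup U i) (List.lookup U j)
  ; sym    = λ i j → sym G _ _
  ; irrefl = λ i → irrefl G _
  }

unique-lookup-injective : {U : List A} → Unique U → ∀ {i j} →
                          List.lookup U i ≡ List.lookup U j → i ≡ j
unique-lookup-injective u@(_ ∷ _) {zero}  {zero}  _  = refl
unique-lookup-injective u@(_ ∷ _) {zero}  {suc j} eq =
  contradiction (subst (_∈ _) (≡.sym eq) (∈-lookup j)) (unique-head u)
unique-lookup-injective u@(_ ∷ _) {suc i} {zero}  eq =
  contradiction (subst (_∈ _) eq (∈-lookup i)) (unique-head u)
unique-lookup-injective (_ ∷ u) {suc i} {suc j} eq = cong suc (unique-lookup-injective u eq)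

∈-index : {U : List A} {x : A} → x ∈ U → ∃[ i ] List.lookup U i ≡ x
∈-index x∈ = Any.index x∈ , ≡.sym (lookup-index x∈)

-- Vertices are renamed by their positions in `U`. Restricting to `U` is injective on these sets
-- since they lie inside `U`, and an extension in the induced graph maps back to an extension in
-- `G`.
bounded-induced : ∀ {d} {G : Graph n} {U} → Unique U →
  Bounded (MaximalIn d G U) (numMaxDegenerate d (induced G U))
bounded-induced {n} {d} {G} {U} u = bounded-injection restrict pres inj (bounded-maximal d (induced G U))
  where
  at = List.lookup U
  restrict : VSet n → VSet (length U)
  restrict S = tabulate (lookup S ∘ at)
  restrict⁺ : ∀ {S i} → at i ∈ₛ S → i ∈ₛ restrict S
  restrict⁺ {S} {i} h = member (trans (lookup∘tabulate (lookup S ∘ at) i) (isMember h))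
  restrict⁻ : ∀ {S i} → i ∈ₛ restrict S → at i ∈ₛ S
  restrict⁻ {S} {i} h = member (trans (≡.sym (lookup∘tabulate (lookup S ∘ at) i)) (isMember h))
  pres : ∀ {S} → MaximalIn d G U S → MaximalIn d (induced G U) (allFin _) (restrict S)
  pres {S} max = record
    { inside     = λ _ → ∈-allFin _
    ; degenerate = degenerate-preimage at (λ _ _ → refl) {S = restrict S} {S}
        (unique-lookup-injective u) restrict⁻ (degenerate max)
    ; maximal    = λ {i} _ i∉ deg → maximal max (∈-lookup i) (i∉ ∘ restrict⁺)
        (degenerate-image at (λ _ _ → refl) (lift i) deg)
    }
    where
    lift : ∀ i {y} → y ∈ₛ insert (at i) S → ∃[ j ] at j ≡ y × j ∈ₛ insert i (restrict S)
    lift i {y} y∈ with y ≟ at i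
    ... | yes refl = i , refl , ∈-insert-self i (restrict S)
    ... | no y≢    with y∈S ← ∈-insert⁻ S y∈ y≢ with j , refl ← ∈-index (inside max y∈S) =
      j , refl , ∈-insert⁺ i (restrict S) (restrict⁺ y∈S)
  back : ∀ {S T} → MaximalIn d G U S → restrict S ≡ restrict T → ∀ {x} → x ∈ₛ S → x ∈ₛ T
  back maxS eq x∈ with i , refl ← ∈-index (inside maxS x∈) =
    restrict⁻ (subst (i ∈ₛ_) eq (restrict⁺ x∈))
  inj : ∀ {S T} → MaximalIn d G U S → MaximalIn d G U T → restrict S ≡ restrict T → S ≡ T
  inj maxS maxT eq = VSet-ext (back maxS eq) (back maxT (≡.sym eq))

addIsolated : Graph n → Graph (suc n)
addIsolated {n} G = record
  { adj    = adj′
  ; sym    = λ { zero zero → refl ; zero (suc _) → refl ; (suc _) zero → refl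
               ; (suc u) (suc v) → sym G u v }
  ; irrefl = λ { zero → refl ; (suc v) → irrefl G v }
  }
  where
  adj′ : Fin (suc n) → Fin (suc n) → Bool
  adj′ (suc u) (suc v) = adj G u v
  adj′ _       _       = false

-- An isolated vertex can be added to any degenerate set, so prepending `true` sends maximal sets to
-- maximal sets. Iterated, this makes the maximum number of maximal sets monotone in the number of
-- vertices.
numMax-addIsolated : (d : ℕ) (G : Graph n) → numMaxDegenerate d G ≤ numMaxDegenerate d (addIsolated G)
numMax-addIsolated {n} d G = numMax-bounded
  (bounded-injection (true ∷_) pres (λ { _ _ refl → refl }) (bounded-maximal d (addIsolated G)))
  where
  pres : ∀ {S} → MaximalIn d G (allFin n) S → MaximalIn d (addIsolated G) (allFin _) (true ∷ S)
  pres {S} max = record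
    { inside     = λ _ → ∈-allFin _
    ; degenerate = deg′
    ; maximal    = max′
    }
    where
    deg′ : Degenerate d (addIsolated G) (true ∷ S)
    deg′ .lowDegree l u ne sub with zero ∈? l
    ... | yes 0∈ = zero , 0∈ ,
      ≤-trans (≤-reflexive (count-none (adj (addIsolated G) zero) l λ _ → refl)) z≤n
    ... | no 0∉  =
      lowDegree (degenerate-image {H = addIsolated G} suc (λ _ _ → refl) {T = false ∷ S} unsuc (degenerate max)) l u ne
      λ { {zero} 0∈ → contradiction 0∈ 0∉ ; {suc i} i∈ → member (isMember (sub i∈)) }
      where
      unsuc : ∀ {y} → y ∈ₛ false ∷ S → ∃[ i ] suc i ≡ y × i ∈ₛ S
      unsuc {suc i} (member i∈) = i , refl , member i∈
    max′ : ∀ {x} → x ∈ allFin _ → x ∉ₛ true ∷ S → ¬ Degenerate d (addIsolated G) (insert x (true ∷ S))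
    max′ {zero}  _ x∉ _   = x∉ (member refl)
    max′ {suc i} _ x∉ deg = maximal max (∈-allFin i) (x∉ ∘ member ∘ isMember)
      (degenerate-preimage {H = addIsolated G} suc (λ _ _ → refl) {T = insert (suc i) (true ∷ S)} suc-injective
        (member ∘ isMember) deg)

numMax-enlarge : ∀ {m N} → m ≤ N → (d : ℕ) (G : Graph m) →
                 Σ (Graph N) λ H → numMaxDegenerate d G ≤ numMaxDegenerate d H
numMax-enlarge {N = N} m≤N d G with m≤n⇒m<n∨m≡n m≤N
... | inj₂ refl = G , ≤-refl
numMax-enlarge {N = suc N} _ d G | inj₁ (s≤s m≤N) =
  let H , le = numMax-enlarge m≤N d G in addIsolated H , ≤-trans le (numMax-addIsolated d H)

bounded-in-small : ∀ {d N} {G : Graph n} {U} → length U ≤ N →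
  Σ (Graph N) λ H → Bounded (MaximalIn d G U) (numMaxDegenerate d H)
bounded-in-small {d = d} {G = G} {U} U≤N =
  -- Repetitions are removed first, since positions in the list have to name distinct vertices.
  let V = deduplicate _≟_ U
      H , le = numMax-enlarge (≤-trans (length-deduplicate _≟_ U) U≤N) d (induced G V)
  in H , bounded-≤ le (bounded-⊆
       (λ max → maximalIn-restrict (∈-deduplicate⁻ _≟_ U) (∈-deduplicate⁺ _≟_ ∘ inside max) max)
       (bounded-induced (deduplicate-! _≟_ U)))

-- Maximal independent sets

record MIS (G : Graph n) (L : Fin n → Set) (I : VSet n) : Set where
  field
    within      : ∀ {x} → x ∈ₛ I → L x
    independent : ∀ {x y} → x ∈ₛ I → y ∈ₛ I → adj G x y ≡ false
    dominating  : ∀ {x} → L x → x ∉ₛ I → ∃[ y ] y ∈ₛ I × adj G x y ≡ true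
open MIS

length-allFin : ∀ n → length (allFin n) ≡ n
length-allFin n = length-tabulate id

bounded-Fin : ∀ n → Bounded {A = Fin n} (λ _ → ⊤) n
bounded-Fin n xs u _ =
  ≤-trans (unique-length-≤ u λ _ → ∈-allFin _) (≤-reflexive (length-allFin n))

clique-degree : {G : Graph n} {l : List (Fin n)} → Unique l →
  (∀ {i j} → i ∈ l → j ∈ l → i ≢ j → adj G i j ≡ true) →
  ∀ {v} → v ∈ l → length l ≤ suc (countᵇ (adj G v) l)
clique-degree {G = G} {l} u clique {v} v∈ =
  subst (λ k → length l ≤ suc k) (length-select (adj G v) l) (unique-length-≤ u cover)
  where
  cover : ∀ {x} → x ∈ l → x ∈ v ∷ select (adj G v) l
  cover {x} x∈ with v ≟ x
  ... | yes refl = here refl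
  ... | no v≢x   = there (∈-select⁺ (adj G v) l x∈ (clique v∈ x∈ v≢x))

isYes-sym : (x y : Fin n) → ⌊ x ≟ y ⌋ ≡ ⌊ y ≟ x ⌋
isYes-sym x y with x ≟ y | y ≟ x
... | yes _   | yes _   = refl
... | no _    | no _    = refl
... | yes x≡y | no y≢x  = contradiction (≡.sym x≡y) y≢x
... | no x≢y  | yes y≡x = contradiction (≡.sym y≡x) x≢y

-- Blowing every vertex up into a clique K_{d+1} turns maximal independent sets into maximal
-- d-degenerate sets: adding a vertex of a block adjacent to a chosen block creates a K_{d+2}.
module BlowUp (d : ℕ) (G : Graph n) where

  quo : Fin (n * suc d) → Fin n
  quo = proj₁ ∘ remQuot (suc d)

  rem : Fin (n * suc d) → Fin (suc d)
  rem = proj₂ ∘ remQuot {n} (suc d)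

  quo-combine : ∀ x r → quo (combine x r) ≡ x
  quo-combine x r = cong proj₁ (remQuot-combine x r)

  quo-rem-injective : ∀ {i j} → quo i ≡ quo j → rem i ≡ rem j → i ≡ j
  quo-rem-injective {i} {j} eq₁ eq₂ = trans (≡.sym (combine-remQuot {n} (suc d) i))
    (trans (cong₂ combine eq₁ eq₂) (combine-remQuot {n} (suc d) j))

  adj′ : Fin (n * suc d) → Fin (n * suc d) → Bool
  adj′ i j = (⌊ quo i ≟ quo j ⌋ ∧ not ⌊ i ≟ j ⌋) ∨ adj G (quo i) (quo j)

  blowUp : Graph (n * suc d)
  blowUp = record { adj = adj′ ; sym = sym′ ; irrefl = irrefl′ }
    where
    sym′ : ∀ i j → adj′ i j ≡ adj′ j i
    sym′ i j = cong₂ _∨_ (cong₂ (λ a b → a ∧ not b) (isYes-sym (quo i) (quo j)) (isYes-sym i j))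
                         (sym G (quo i) (quo j))
    irrefl′ : ∀ i → adj′ i i ≡ false
    irrefl′ i rewrite isYes⁺ (quo i ≟ quo i) refl | isYes⁺ (i ≟ i) refl = irrefl G (quo i)

  adj-block : ∀ {i j} → quo i ≡ quo j → i ≢ j → adj′ i j ≡ true
  adj-block {i} {j} eq i≢j with quo i ≟ quo j | i ≟ j
  ... | no neq | _       = contradiction eq neq
  ... | yes _  | yes i≡j = contradiction i≡j i≢j
  ... | yes _  | no _    = refl

  adj-join : ∀ {i j} → adj G (quo i) (quo j) ≡ true → adj′ i j ≡ true
  adj-join {i} {j} h rewrite h = ∨-zeroʳ _

  adj-nonadjacent⁻ : ∀ {i j} → adj G (quo i) (quo j) ≡ false → adj′ i j ≡ true → quo i ≡ quo j × i ≢ j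
  adj-nonadjacent⁻ {i} {j} h eq rewrite h | ∨-identityʳ (⌊ quo i ≟ quo j ⌋ ∧ not ⌊ i ≟ j ⌋) =
    let same , diff = ∧-true⁻ eq in
    isYes⁻ (quo i ≟ quo j) same , λ i≡j → true≢false (isYes⁺ (i ≟ j) i≡j) (not-true⁻ diff)

  blocks : List (Fin n) → List (Fin (n * suc d))
  blocks Q = cartesianProductWith combine Q (allFin (suc d))

  lift : VSet n → VSet (n * suc d)
  lift J = tabulate (lookup J ∘ quo)

  lift⁺ : ∀ {J i} → quo i ∈ₛ J → i ∈ₛ lift J
  lift⁺ {J} {i} h = member (trans (lookup∘tabulate (lookup J ∘ quo) i) (isMember h))

  lift⁻ : ∀ {J i} → i ∈ₛ lift J → quo i ∈ₛ J
  lift⁻ {J} {i} h = member (trans (≡.sym (lookup∘tabulate (lookup J ∘ quo) i)) (isMember h))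

  bounded-block : ∀ q → Bounded (λ i → quo i ≡ q) (suc d)
  bounded-block q = bounded-injection rem _
    (λ qi qj eq → quo-rem-injective (trans qi (≡.sym qj)) eq) (bounded-Fin (suc d))

  -- Over an independent set no edges join different blocks, so a vertex has all its neighbours
  -- among the other `d` members of its own block; any vertex of the list is a witness.
  lift-degenerate : ∀ {J} → (∀ {x y} → x ∈ₛ J → y ∈ₛ J → adj G x y ≡ false) →
                    Degenerate d blowUp (lift J)
  lift-degenerate {J} indep .lowDegree l u (i , i∈) sub = i , i∈ , ≤-pred
    (subst (λ k → suc k ≤ suc d) (length-select (adj′ i) l)
      (bounded-block (quo i) (i ∷ select (adj′ i) l)
        (unique-cons (λ i∈s → proj₂ (selected i∈s) refl) (unique-select (adj′ i) u))
        (refl ∷ All.tabulate (≡.sym ∘ proj₁ ∘ selected))))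
    where
    selected : ∀ {j} → j ∈ select (adj′ i) l → quo i ≡ quo j × i ≢ j
    selected j∈ = let j∈l , ij = ∈-select⁻ (adj′ i) l j∈ in
      adj-nonadjacent⁻ (indep (lift⁻ (sub i∈)) (lift⁻ (sub j∈l))) ij

  block : Fin n → List (Fin (n * suc d))
  block y = map (combine y) (allFin (suc d))

  quo-block : ∀ {y i} → i ∈ block y → quo i ≡ y
  quo-block {y} i∈ with r , _ , refl ← ∈-map⁻ (combine y) i∈ = quo-combine y r

  lift-saturated : ∀ {T : VSet (n * suc d)} {x y} → adj G (quo x) y ≡ true → x ∈ₛ T →
    (∀ {i} → quo i ≡ y → i ∈ₛ T) → ¬ Degenerate d blowUp T
  lift-saturated {T} {x} {y} xy x∈T block⊆T deg =
    let v , v∈ , le = lowDegree deg l unique-l (x , here refl) inT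
    in <⇒≱ (s≤s (s≤s le)) 
         (≤-trans (≤-reflexive (≡.sym length-l)) (clique-degree {G = blowUp} unique-l clique v∈))
    where
    l = x ∷ block y
    length-l : length l ≡ suc (suc d)
    length-l = cong suc (trans (length-map (combine y) (allFin (suc d))) (length-allFin (suc d)))
    x∉block : x ∉ block y
    x∉block x∈ = true≢false xy (trans (cong (λ q → adj G q y) (quo-block x∈)) (irrefl G y))
    unique-l : Unique l
    unique-l = unique-cons x∉block
      (Unique.map⁺ (λ {i} {j} → combine-injectiveʳ y i y j) (Unique.allFin⁺ (suc d)))
    inT : ∀ {i} → i ∈ l → i ∈ₛ T
    inT (here refl) = x∈T
    inT (there i∈)  = block⊆T (quo-block i∈)
    clique : ∀ {i j} → i ∈ l → j ∈ l → i ≢ j → adj′ i j ≡ true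
    clique (here refl) (here refl) i≢j = contradiction refl i≢j
    clique {i} {j} (here refl) (there j∈) _ =
      adj-join {i} {j} (trans (cong (adj G (quo x)) (quo-block j∈)) xy)
    clique {i} {j} (there i∈) (here refl) _ =
      adj-join {i} {j} (trans (sym G _ _) (trans (cong (adj G (quo x)) (quo-block i∈)) xy))
    clique (there i∈) (there j∈) i≢j = adj-block (trans (quo-block i∈) (≡.sym (quo-block j∈))) i≢j

  lift-maximal : ∀ {Q J} → MIS G (_∈ Q) J → MaximalIn d blowUp (blocks Q) (lift J)
  lift-maximal {Q} {J} mis = record
    { inside     = λ {i} i∈ → subst (_∈ blocks Q) (combine-remQuot {n} (suc d) i)
        (∈-cartesianProductWith⁺ combine (within mis (lift⁻ i∈)) (∈-allFin _))
    ; degenerate = lift-degenerate (independent mis)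
    ; maximal    = saturated
    }
    where
    saturated : ∀ {i} → i ∈ blocks Q → i ∉ₛ lift J → ¬ Degenerate d blowUp (insert i (lift J))
    saturated {i} i∈ i∉ with ∈-cartesianProductWith⁻ combine Q (allFin (suc d)) i∈
    ... | q , r , q∈ , _ , refl
      with y , y∈ , qy ← dominating mis (subst (_∈ Q) (≡.sym (quo-combine q r)) q∈) (i∉ ∘ lift⁺) =
      lift-saturated qy (∈-insert-self _ (lift J)) λ eq →
        ∈-insert⁺ _ (lift J) (lift⁺ (subst (_∈ₛ J) (≡.sym eq) y∈))

  lift-injective : ∀ {I J} → lift I ≡ lift J → I ≡ J
  lift-injective {I} {J} eq = VSet-ext (down eq) (down (≡.sym eq))
    where
    down : ∀ {I J} → lift I ≡ lift J → ∀ {x} → x ∈ₛ I → x ∈ₛ J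
    down {I} {J} eq {x} x∈ = subst (_∈ₛ J) (quo-combine x zero) (lift⁻ (subst (combine x zero ∈ₛ_) eq
      (lift⁺ (subst (_∈ₛ I) (≡.sym (quo-combine x zero)) x∈))))

-- All of `G` is blown up, but only the blocks over `Q` serve as ambient set; `lift` embeds the
-- maximal independent sets of `Q` into the maximal d-degenerate sets there.
bounded-MIS-small : ∀ {d N} {G : Graph n} {Q} → length Q * suc d ≤ N →
  Σ (Graph N) λ H → Bounded (MIS G (_∈ Q)) (numMaxDegenerate d H)
bounded-MIS-small {d = d} {N} {G} {Q} le =
  let H , h = bounded-in-small (≤-trans (≤-reflexive length-blocks) le)
  in H , bounded-injection lift lift-maximal (λ _ _ → lift-injective) h
  where
  open BlowUp d G
  length-blocks : length (blocks Q) ≡ length Q * suc d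
  length-blocks = trans (length-cartesianProductWith combine Q (allFin (suc d)))
    (cong (length Q *_) (length-allFin (suc d)))

-- Extremal elements of decidable subsets of Fin n

largest : {P : Fin n → Set} → Decidable P →
          (∀ i → ¬ P i) ⊎ ∃[ i ] P i × (∀ {j} → P j → toℕ j ≤ toℕ i)
largest {zero}  P? = inj₁ λ ()
largest {suc n} P? with largest (P? ∘ suc)
... | inj₂ (i , p , max) =
  inj₂ (suc i , p , λ { {zero} _ → z≤n ; {suc j} pj → s≤s (max pj) })
... | inj₁ none with P? zero
...   | yes p = inj₂ (zero , p , λ { {zero} _ → z≤n ; {suc j} pj → contradiction pj (none j) })
...   | no ¬p = inj₁ λ { zero → ¬p ; (suc i) → none i }

smallest : {P : Fin n → Set} → Decidable P → ∃ P → ∃[ i ] P i × (∀ {j} → P j → toℕ i ≤ toℕ j)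
smallest {suc n} P? (i , p) with P? zero
... | yes p₀ = zero , p₀ , λ _ → z≤n
smallest {suc n} P? (zero  , p) | no ¬p₀ = contradiction p ¬p₀
smallest {suc n} P? (suc i , p) | no ¬p₀ with smallest (P? ∘ suc) (i , p)
... | j , pj , min = suc j , pj , λ { {zero} p₀ → contradiction p₀ ¬p₀ ; {suc k} pk → s≤s (min pk) }

-- Maximal independent sets of the complement of a c-closed graph

-- From position `t` on, `I` rejects a vertex only because of an earlier neighbour, as the greedy
-- algorithm in the vertex order does. For `t` equal to 0 this describes the greedy independent set.
GreedyFrom : Graph n → (Fin n → Set) → ℕ → VSet n → Set
GreedyFrom G L t I = ∀ {x} → L x → x ∉ₛ I → t ≤ toℕ x →
                     ∃[ y ] y ∈ₛ I × adj G x y ≡ true × toℕ y < toℕ x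

-- Strong induction along the vertex order: if `x` lies in `I` but not in `J`, its earlier neighbour
-- in `J` also lies in `I` by induction, against independence.
greedy-unique : ∀ {G : Graph n} {L t I J} → MIS G L I → MIS G L J → GreedyFrom G L t I →
  GreedyFrom G L t J → (∀ {x} → toℕ x < t → x ∈ₛ I → x ∈ₛ J) →
  (∀ {x} → toℕ x < t → x ∈ₛ J → x ∈ₛ I) → I ≡ J
greedy-unique {n} {G} {L} {t} {I} {J} mI mJ gI gJ ij ji =
  VSet-ext (λ {x} → proj₁ (agree (suc (toℕ x)) ≤-refl)) (λ {x} → proj₂ (agree (suc (toℕ x)) ≤-refl))
  where
  forced : ∀ {I J} → MIS G L I → GreedyFrom G L t J → ∀ {x} → t ≤ toℕ x →
    (∀ {y} → toℕ y < toℕ x → y ∈ₛ J → y ∈ₛ I) → x ∈ₛ I → x ∈ₛ J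
  forced {I} {J} mI gJ {x} t≤x below x∈I with x ∈ₛ? J
  ... | yes x∈J = x∈J
  ... | no x∉J  =
    let y , y∈J , xy , y<x = gJ (within mI x∈I) x∉J t≤x
    in contradiction (independent mI x∈I (below y<x y∈J)) (true≢false xy)
  agree : ∀ b {x} → toℕ x < b → (x ∈ₛ I → x ∈ₛ J) × (x ∈ₛ J → x ∈ₛ I)
  agree (suc b) {x} (s≤s x≤b) with toℕ x <? t
  ... | yes x<t = ij x<t , ji x<t
  ... | no x≮t  =
    forced mI gJ (≮⇒≥ x≮t) (λ y<x → proj₂ (agree b (<-≤-trans y<x x≤b))) ,
    forced mJ gI (≮⇒≥ x≮t) (λ y<x → proj₁ (agree b (<-≤-trans y<x x≤b)))

module _ (G : Graph n) where

  nonNeighbour : Fin n → Fin n → Fin n → Bool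
  nonNeighbour u v w = not (adj G u w) ∧ not (adj G v w) ∧ not ⌊ w ≟ u ⌋ ∧ not ⌊ w ≟ v ⌋

  nonNeighbours : Fin n → Fin n → List (Fin n)
  nonNeighbours u v = select (nonNeighbour u v) (allFin n)

  length-nonNeighbours : ∀ {c} → CoClosed c G → ∀ {u v} → adj G u v ≡ true →
                         length (nonNeighbours u v) < c
  length-nonNeighbours closed {u} {v} uv =
    subst (_< _) (≡.sym (length-select (nonNeighbour u v) (allFin n))) (closed u v uv)

  ∈-nonNeighbours : ∀ {u v w} → adj G u w ≡ false → adj G v w ≡ false → w ≢ u → w ≢ v →
                    w ∈ nonNeighbours u v
  ∈-nonNeighbours {u} {v} {w} uw vw w≢u w≢v = ∈-select⁺ (nonNeighbour u v) (allFin n) (∈-allFin w)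
    (∧-true⁺ (cong not uw) (∧-true⁺ (cong not vw) (∧-true⁺ (distinct w≢u) (distinct w≢v))))
    where
    distinct : ∀ {x y : Fin n} → x ≢ y → not ⌊ x ≟ y ⌋ ≡ true
    distinct {x} {y} x≢y = cong not (¬-not (x≢y ∘ isYes⁻ (x ≟ y)))

module _ {G : Graph n} {L : Fin n → Set} (L? : Decidable L) where

  -- A failure of greediness: `w` is rejected although its first neighbour `v` in `I` comes only
  -- after it.
  record Critical (I : VSet n) (w v : Fin n) : Set where
    constructor critical
    field
      w∈L   : L w
      w∉I   : w ∉ₛ I
      v∈I   : v ∈ₛ I
      wv    : adj G w v ≡ true
      w<v   : toℕ w < toℕ v
      least : ∀ y → y ∈ₛ I → adj G w y ≡ true → toℕ v ≤ toℕ y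
  open Critical

  critical? : ∀ I w v → Dec (Critical I w v)
  critical? I w v = Dec.map′ (λ (a , b , c , d , e , f) → critical a b c d e f)
    (λ (critical a b c d e f) → a , b , c , d , e , f)
    (L? w ×-dec ¬? (w ∈ₛ? I) ×-dec v ∈ₛ? I ×-dec (adj G w v ≟ᵇ true) ×-dec (toℕ w <? toℕ v) ×-dec
     all? λ y → (y ∈ₛ? I) →-dec ((adj G w y ≟ᵇ true) →-dec (toℕ v ≤? toℕ y)))

  -- The first neighbour of `x` in `I` decides: it differs from `x`, so it either precedes `x` or
  -- forms a critical pair with it.
  earlier-or-critical : ∀ {I x} → MIS G L I → L x → x ∉ₛ I →
    ∃[ y ] y ∈ₛ I × adj G x y ≡ true × (toℕ y < toℕ x ⊎ Critical I x y)
  earlier-or-critical {I} {x} mis x∈L x∉I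
    with y , (y∈ , xy) , least ← smallest (λ y → y ∈ₛ? I ×-dec (adj G x y ≟ᵇ true))
                                          (dominating mis x∈L x∉I)
    with toℕ y <? toℕ x
  ... | yes y<x = y , y∈ , xy , inj₁ y<x
  ... | no y≮x  = y , y∈ , xy , inj₂ (critical x∈L x∉I y∈ xy
    (≤∧≢⇒< (≮⇒≥ y≮x) (λ eq → x∉I (subst (_∈ₛ I) (≡.sym (toℕ-injective eq)) y∈)))
    (λ z z∈ xz → least (z∈ , xz)))

  -- Among all critical pairs the one with the last `v` is taken, so that beyond `v` nothing
  -- contradicts greediness.
  Anchored : Fin n → Fin n → VSet n → Set
  Anchored w v I = MIS G L I × Critical I w v × (∀ {x y} → Critical I x y → toℕ y ≤ toℕ v)

  greedy-or-anchored : ∀ {I} → MIS G L I →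
    (MIS G L I × GreedyFrom G L 0 I) ⊎ ∃[ w ] ∃[ v ] Anchored w v I
  greedy-or-anchored {I} mis with largest (λ v → any? λ w → critical? I w v)
  ... | inj₁ none = inj₁ (mis , λ x∈L x∉I _ → case earlier-or-critical mis x∈L x∉I of λ where
    (y , y∈ , xy , inj₁ y<x) → y , y∈ , xy , y<x
    (y , _ , _ , inj₂ crit)  → contradiction (_ , crit) (none y))
  ... | inj₂ (v , (w , crit) , max) = inj₂ (w , v , mis , crit , λ crit′ → max (_ , crit′))

  -- Even if `x` beyond `v` formed a critical pair with `y`, the choice of `v` puts `y` at or before
  -- `v`, hence before `x`.
  anchored-greedy : ∀ {w v I} → Anchored w v I → GreedyFrom G L (suc (toℕ v)) I
  anchored-greedy (mis , _ , max) x∈L x∉I v<x with earlier-or-critical mis x∈L x∉I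
  ... | y , y∈ , xy , inj₁ y<x  = y , y∈ , xy , y<x
  ... | y , y∈ , xy , inj₂ crit = y , y∈ , xy , <-≤-trans (s≤s (max crit)) v<x

  -- The part of I below v avoids the neighbourhoods of both ends of the edge wv, so it lives on
  -- fewer than c vertices; the part above v is then forced greedily.
  module _ {c : ℕ} (closed : CoClosed c G) {D : ℕ}
           (small : ∀ {Q} → length Q < c → Bounded (MIS G (_∈ Q)) D) where

    module _ (w v : Fin n) where

      belowAnchor? : Decidable (λ x → L x × toℕ x < toℕ v)
      belowAnchor? x = L? x ×-dec (toℕ x <? toℕ v)

      support : List (Fin n)
      support = filter belowAnchor? (nonNeighbours G w v)

      below? : (I : VSet n) → Decidable (λ x → x ∈ₛ I × toℕ x < toℕ v)
      below? I x = x ∈ₛ? I ×-dec (toℕ x <? toℕ v)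

      below : VSet n → VSet n
      below I = fromDec (below? I)

      below-MIS : ∀ {I} → Anchored w v I → MIS G (_∈ support) (below I)
      below-MIS {I} anch@(mis , crit , max) = record
        -- A vertex of `I` before `v` is not adjacent to `w`, whose first neighbour in `I` is `v`,
        -- nor to `v`, by independence.
        { within      = λ x∈ → let x∈I , x<v = ∈-fromDec⁻ (below? I) x∈ in
            ∈-filter⁺ belowAnchor? (∈-nonNeighbours G
              (¬-not λ wx → <⇒≱ x<v (least crit _ x∈I wx)) (independent mis (v∈I crit) x∈I)
              (λ { refl → w∉I crit x∈I }) (λ { refl → <-irrefl refl x<v }))
            (within mis x∈I , x<v)
        ; independent = λ x∈ y∈ → independent mis (proj₁ (∈-fromDec⁻ (below? I) x∈))
                                                  (proj₁ (∈-fromDec⁻ (below? I) y∈))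
        ; dominating  = dom
        }
        where
        dom : ∀ {x} → x ∈ support → x ∉ₛ below I → ∃[ y ] y ∈ₛ below I × adj G x y ≡ true
        dom {x} x∈ x∉ with x∈nn , x∈L , x<v ← ∈-filter⁻ belowAnchor? {xs = nonNeighbours G w v} x∈
          with earlier-or-critical mis x∈L (λ x∈I → x∉ (∈-fromDec⁺ (below? I) (x∈I , x<v)))
        ... | y , y∈ , xy , inj₁ y<x  = y , ∈-fromDec⁺ (below? I) (y∈ , <-trans y<x x<v) , xy
        ... | y , y∈ , xy , inj₂ crit′ = y , ∈-fromDec⁺ (below? I) (y∈ , y<v) , xy
          where
          vx : adj G v x ≡ false
          vx = not-true⁻ (proj₁ (∧-true⁻ (proj₂ (∧-true⁻ {not (adj G w x)}
                 (proj₂ (∈-select⁻ (nonNeighbour G w v) (allFin n) x∈nn))))))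
          y<v : toℕ y < toℕ v
          y<v = ≤∧≢⇒< (max crit′) λ eq → true≢false xy
            (trans (sym G x y) (subst (λ z → adj G z x ≡ false) (≡.sym (toℕ-injective eq)) vx))

      -- The part before `v` is recorded, `v` itself belongs to both sets, and everything after `v`
      -- is forced by `greedy-unique`.
      below-injective : ∀ {I J} → Anchored w v I → Anchored w v J → below I ≡ below J → I ≡ J
      below-injective {I} {J} aI aJ eq = greedy-unique (proj₁ aI) (proj₁ aJ)
        (anchored-greedy aI) (anchored-greedy aJ) (down aJ eq) (down aI (≡.sym eq))
        where
        down : ∀ {I J} → Anchored w v J → below I ≡ below J →
               ∀ {x} → toℕ x < suc (toℕ v) → x ∈ₛ I → x ∈ₛ J
        down {I} {J} (_ , crit , _) eq {x} (s≤s x≤v) x∈ with m≤n⇒m<n∨m≡n x≤v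
        ... | inj₁ x<v = proj₁ (∈-fromDec⁻ (below? J)
                           (subst (x ∈ₛ_) eq (∈-fromDec⁺ (below? I) (x∈ , x<v))))
        ... | inj₂ x≡v = subst (_∈ₛ J) (≡.sym (toℕ-injective x≡v)) (v∈I crit)

      bounded-anchored : Bounded (Anchored w v) D
      bounded-anchored = bounded-⊆ (λ a → wv (proj₁ (proj₂ a)) , a) (bounded-guard λ adj-wv →
        bounded-injection below below-MIS below-injective
          (small (≤-<-trans (length-filter belowAnchor? (nonNeighbours G w v))
                            (length-nonNeighbours G closed adj-wv))))

    -- The summand 1 counts the greedy set; the remaining sets are counted over the choices of the
    -- anchor `w`, `v`.
    bounded-MIS : Bounded (MIS G L) (1 + n * (n * D))
    bounded-MIS = bounded-⊆ greedy-or-anchored (bounded-⊎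
      (bounded-subsingleton λ (mI , gI) (mJ , gJ) → greedy-unique mI mJ gI gJ (λ ()) (λ ()))
      (bounded-≤ (≤-reflexive (cong (λ k → k * (k * D)) (length-allFin n)))
        (bounded-⊆ (λ (w , v , a) → w , ∈-allFin w , v , ∈-allFin v , a)
          (bounded-∃ (allFin n) λ w → bounded-∃ (allFin n) λ v → bounded-anchored w v))))

-- Matchings

flat : List (A × A) → List A
flat []            = []
flat ((u , v) ∷ M) = u ∷ v ∷ flat M

flat-++ : (M N : List (A × A)) → flat (M ++ N) ≡ flat M ++ flat N
flat-++ []            N = refl
flat-++ ((u , v) ∷ M) N = cong (λ l → u ∷ v ∷ l) (flat-++ M N)

length-flat : (M : List (A × A)) → length (flat M) ≡ 2 * length M
length-flat []      = refl
length-flat (_ ∷ M) = trans (cong (2 +_) (length-flat M)) (≡.sym (*-suc 2 (length M)))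

∈-flat⁺ : ∀ {u v : A} {M} → (u , v) ∈ M → u ∈ flat M × v ∈ flat M
∈-flat⁺ (here refl) = here refl , there (here refl)
∈-flat⁺ (there p)   = let u∈ , v∈ = ∈-flat⁺ p in there (there u∈) , there (there v∈)

unique-middle : ∀ (as : List A) {x bs} → Unique (as ++ x ∷ bs) → Unique (x ∷ as ++ bs)
unique-middle as {x} {bs} u = unique-cons (fresh as u) (unique-remove as u)
  where
  fresh : ∀ as → Unique (as ++ x ∷ bs) → x ∉ as ++ bs
  fresh []       u        x∈          = unique-head u x∈
  fresh (a ∷ as) (a≢ ∷ _) (here refl) = All.lookup a≢ (∈-insert as) refl
  fresh (a ∷ as) (_ ∷ u)  (there x∈)  = fresh as u x∈

count-flat-≥ : (p : A → Bool) (M : List (A × A)) →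
  (∀ {u v} → (u , v) ∈ M → p u ≡ true ⊎ p v ≡ true) → length M ≤ countᵇ p (flat M)
count-flat-≥ p []            h = z≤n
count-flat-≥ p ((u , v) ∷ M) h with p u | p v | h (here refl) | count-flat-≥ p M (h ∘ there)
... | true  | true  | _       | ih = s≤s (m≤n⇒m≤1+n ih)
... | true  | false | _       | ih = s≤s ih
... | false | true  | _       | ih = s≤s ih
... | false | false | inj₁ () | _
... | false | false | inj₂ () | _

count-flat-≤ : (p : A → Bool) (M : List (A × A)) →
  (∀ {u v} → (u , v) ∈ M → p u ≡ true → p v ≡ true → ⊥) → countᵇ p (flat M) ≤ length M
count-flat-≤ p []            h = z≤n
count-flat-≤ p ((u , v) ∷ M) h with p u | p v | h (here refl) | count-flat-≤ p M (h ∘ there)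
... | true  | true  | no-both | _  = ⊥-elim (no-both refl refl)
... | true  | false | _       | ih = s≤s ih
... | false | true  | _       | ih = s≤s ih
... | false | false | _       | ih = m≤n⇒m≤1+n ih

record Matching (G : Graph n) (S : VSet n) (M : List (Fin n × Fin n)) : Set where
  constructor matching
  field
    unique  : Unique (flat M)
    covered : ∀ {x} → x ∈ flat M → x ∈ₛ S
    edge    : ∀ {u v} → (u , v) ∈ M → adj G u v ≡ true
open Matching

matching? : (G : Graph n) (S : VSet n) → Decidable (Matching G S)
matching? G S M = Dec.map′
  (λ (u , c , e) → matching u (All.lookup c) (All.lookup e))
  (λ m → unique m , All.tabulate (covered m) , All.tabulate (edge m))
  (unique? _≟_ (flat M) ×-dec All.all? (_∈ₛ? S) (flat M) ×-dec
   All.all? (λ (u , v) → adj G u v ≟ᵇ true) M)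

NoMatching : Graph n → VSet n → ℕ → Set
NoMatching G S m = ∀ {M} → Matching G S M → length M ≢ m

pairs : ∀ n → List (Fin n × Fin n)
pairs n = cartesianProduct (allFin n) (allFin n)

∈-pairs : (e : Fin n × Fin n) → e ∈ pairs n
∈-pairs (u , v) = ∈-cartesianProduct⁺ (∈-allFin u) (∈-allFin v)

matching-of-size? : (G : Graph n) (S : VSet n) (m : ℕ) →
  (∃[ M ] Matching G S M × length M ≡ m) ⊎ NoMatching G S m
matching-of-size? {n} G S m
  with Any.any? (λ M → matching? G S M ×-dec (length M ≟ℕ m)) (wordsUpTo (pairs n) m)
... | yes p = let M , _ , q = find p in inj₁ (M , q)
... | no ¬p = inj₂ λ {M} mat eq →
  ¬p (lose (∈-wordsUpTo M (≤-reflexive eq) λ {e} _ → ∈-pairs e) (mat , eq))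

-- The size grows one by one until `t` is reached or the search fails. A failure at the next size is
-- exactly what the augmentation arguments contradict.
matching-up-to : (G : Graph n) (S : VSet n) (t : ℕ) → (∃[ M ] Matching G S M × length M ≡ t) ⊎
  (∃[ M ] Matching G S M × length M < t × NoMatching G S (suc (length M)))
matching-up-to G S zero = inj₁ ([] , matching [] (λ ()) (λ ()) , refl)
matching-up-to G S (suc t) with matching-up-to G S t
... | inj₂ (M , mat , lt , none) = inj₂ (M , mat , m≤n⇒m≤1+n lt , none)
... | inj₁ (M , mat , refl) with matching-of-size? G S (suc t)
...   | inj₁ found = inj₁ found
...   | inj₂ none  = inj₂ (M , mat , ≤-refl , none)

module _ {G : Graph n} {S : VSet n} {M : List (Fin n × Fin n)} (mat : Matching G S M)
         (none : NoMatching G S (suc (length M))) where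

  -- An edge outside `M` could be added to `M`.
  outside-independent : ∀ {x y} → x ∈ₛ S → y ∈ₛ S → x ∉ flat M → y ∉ flat M → adj G x y ≡ false
  outside-independent {x} {y} x∈ y∈ x∉ y∉ = ¬-not λ xy → none {(x , y) ∷ M} (matching
    (unique-cons (λ { (here refl) → true≢false xy (irrefl G x) ; (there x∈M) → x∉ x∈M })
      (unique-cons y∉ (unique mat)))
    (λ { (here refl) → x∈ ; (there (here refl)) → y∈ ; (there (there z∈)) → covered mat z∈ })
    (λ { (here refl) → xy ; (there e∈) → edge mat e∈ })) refl

  -- x u v y would be an augmenting path.
  no-augmenting : ∀ {u v x y} → (u , v) ∈ M → x ∈ₛ S → y ∈ₛ S → x ∉ flat M → y ∉ flat M → x ≢ y →
                  adj G u x ≡ true → adj G v y ≡ true → ⊥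
  no-augmenting {u} {v} {x} {y} e∈ x∈ y∈ x∉ y∉ x≢y ux vy with as , bs , refl ← ∈-∃++ e∈ =
    none {(u , x) ∷ (v , y) ∷ as ++ bs} (matching
      (unique-cons (λ { (here refl) → x∉ (proj₁ (∈-flat⁺ e∈))
                      ; (there (here refl)) → u∉ (here refl)
                      ; (there (there (here refl))) → y∉ (proj₁ (∈-flat⁺ e∈))
                      ; (there (there (there u∈))) → u∉ (there (rest⁻ u∈)) })
        (unique-cons (λ { (here refl) → x∉ (proj₂ (∈-flat⁺ e∈))
                        ; (there (here x≡y)) → x≢y x≡y
                        ; (there (there x∈r)) → x∉ (rest x∈r) })
          (unique-cons (λ { (here refl) → y∉ (proj₂ (∈-flat⁺ e∈))
                          ; (there v∈) → unique-head v-unique (rest⁻ v∈) })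
            (unique-cons (y∉ ∘ rest)
              (subst Unique (≡.sym (flat-++ as bs)) (tail v-unique))))))
      (λ { (here refl) → covered mat (proj₁ (∈-flat⁺ e∈)) ; (there (here refl)) → x∈
         ; (there (there (here refl))) → covered mat (proj₂ (∈-flat⁺ e∈))
         ; (there (there (there (here refl)))) → y∈
         ; (there (there (there (there z∈)))) → covered mat (rest z∈) })
      (λ { (here refl) → ux ; (there (here refl)) → vy
         ; (there (there f∈)) → edge mat
             ([ ∈-++⁺ˡ , ∈-++⁺ʳ as ∘ there ]′ (∈-++⁻ as f∈)) }))
    (cong suc (≡.sym (length-insert as)))
    where
    tail : ∀ {a : Fin n} {l} → Unique (a ∷ l) → Unique l
    tail (_ ∷ u) = u
    rest⁻ : ∀ {z} → z ∈ flat (as ++ bs) → z ∈ flat as ++ flat bs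
    rest⁻ = subst (_ ∈_) (flat-++ as bs)
    rest : ∀ {z} → z ∈ flat (as ++ bs) → z ∈ flat (as ++ (u , v) ∷ bs)
    rest z∈ = subst (_ ∈_) (≡.sym (flat-++ as ((u , v) ∷ bs)))
      ([ ∈-++⁺ˡ , ∈-++⁺ʳ (flat as) ∘ there ∘ there ]′ (∈-++⁻ (flat as) (rest⁻ z∈)))
    u-unique : Unique (u ∷ flat as ++ v ∷ flat bs)
    u-unique = unique-middle (flat as) (subst Unique (flat-++ as ((u , v) ∷ bs)) (unique mat))
    v-unique : Unique (v ∷ flat as ++ flat bs)
    v-unique = unique-middle (flat as) (tail u-unique)
    u∉ : u ∉ v ∷ flat as ++ flat bs
    u∉ (here refl) = unique-head u-unique (∈-insert (flat as))
    u∉ (there u∈)  = unique-head u-unique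
      ([ ∈-++⁺ˡ , ∈-++⁺ʳ (flat as) ∘ there ]′ (∈-++⁻ (flat as) u∈))

-- Edge counts of degenerate sets

-- Each edge is charged to whichever end comes first in the list, so on a duplicate-free list it is
-- counted once.
edgeCount : Graph n → List (Fin n) → ℕ
edgeCount G []      = 0
edgeCount G (x ∷ l) = countᵇ (adj G x) l + edgeCount G l

count-insert : (p : A → Bool) (as : List A) {x : A} {bs : List A} →
               countᵇ p (as ++ x ∷ bs) ≡ countᵇ p (x ∷ as ++ bs)
count-insert p []       = refl
count-insert p (a ∷ as) {x} {bs} with p a | p x | count-insert p as {x} {bs}
... | true  | true  | ih = cong suc ih
... | true  | false | ih = cong suc ih
... | false | true  | ih = ih
... | false | false | ih = ih

+-swap : ∀ x y z → x + (y + z) ≡ y + (x + z)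
+-swap = solve-∀

edgeCount-insert : (G : Graph n) (as : List (Fin n)) {v : Fin n} {bs : List (Fin n)} →
  edgeCount G (as ++ v ∷ bs) ≡ countᵇ (adj G v) (as ++ bs) + edgeCount G (as ++ bs)
edgeCount-insert G []       = refl
edgeCount-insert G (a ∷ as) {v} {bs}
  rewrite count-insert (adj G a) as {v} {bs} | edgeCount-insert G as {v} {bs} | sym G v a
  with adj G a v
... | true  = cong suc (+-swap (countᵇ (adj G a) (as ++ bs)) (countᵇ (adj G v) (as ++ bs)) _)
... | false = +-swap (countᵇ (adj G a) (as ++ bs)) (countᵇ (adj G v) (as ++ bs)) _

-- Vertices of degree at most `d` are removed one after another; the last remaining vertex
-- contributes no edge, whence `k` rather than `suc k`.
edgeCount-≤ : ∀ {d} {G : Graph n} {S} → Degenerate d G S → ∀ k {l} → length l ≡ suc k →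
  Unique l → (∀ {x} → x ∈ l → x ∈ₛ S) → edgeCount G l ≤ d * k
edgeCount-≤ deg zero    {_ ∷ []}    refl u sub = z≤n
edgeCount-≤ {d = d} {G} deg (suc k) {l@(x ∷ _)} len u sub
  with v , v∈ , le ← lowDegree deg l u (x , here refl) sub
  with as , bs , eq ← ∈-∃++ v∈ = begin
    edgeCount G l                                          ≡⟨ cong (edgeCount G) eq ⟩
    edgeCount G (as ++ v ∷ bs)                             ≡⟨ edgeCount-insert G as ⟩
    countᵇ (adj G v) (as ++ bs) + edgeCount G (as ++ bs)   ≤⟨ +-mono-≤ degree rest ⟩
    d + d * k                                              ≡⟨ *-suc d k ⟨
    d * suc k                                              ∎
  where
  open ≤-Reasoning
  u′ : Unique (as ++ bs)
  u′ = unique-remove as (subst Unique eq u)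
  widen : ∀ {y} → y ∈ as ++ bs → y ∈ l
  widen y∈ = subst (_ ∈_) (≡.sym eq) ([ ∈-++⁺ˡ , ∈-++⁺ʳ as ∘ there ]′ (∈-++⁻ as y∈))
  degree : countᵇ (adj G v) (as ++ bs) ≤ d
  degree = ≤-trans (count-≤ _ _ u′ λ y∈ vy → widen y∈ , vy) le
  rest : edgeCount G (as ++ bs) ≤ d * k
  rest = edgeCount-≤ deg k
    (cong pred (trans (≡.sym (length-insert as)) (trans (cong length (≡.sym eq)) len))) u′ (sub ∘ widen)

edgeCount-flat : {G : Graph n} (M : List (Fin n × Fin n)) →
  (∀ {u v} → (u , v) ∈ M → adj G u v ≡ true) → length M ≤ edgeCount G (flat M)
edgeCount-flat []            h = z≤n
edgeCount-flat {G = G} ((u , v) ∷ M) h rewrite h (here refl) =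
  s≤s (≤-trans (edgeCount-flat M (h ∘ there)) (≤-trans (m≤n+m _ _) (m≤n+m _ (countᵇ (adj G u) (flat M)))))

edgeCount-join : {G : Graph n} {m : ℕ} (Z F : List (Fin n)) →
  (∀ {w} → w ∈ Z → m ≤ countᵇ (adj G w) F) → length Z * m + edgeCount G F ≤ edgeCount G (Z ++ F)
edgeCount-join []      F h = ≤-refl
edgeCount-join {G = G} {m} (w ∷ Z) F h = begin
  m + length Z * m + edgeCount G F   ≡⟨ +-assoc m _ _ ⟩
  m + (length Z * m + edgeCount G F) ≤⟨ +-mono-≤ degree (edgeCount-join Z F (h ∘ there)) ⟩
  countᵇ (adj G w) (Z ++ F) + edgeCount G (Z ++ F) ∎
  where
  open ≤-Reasoning
  degree : m ≤ countᵇ (adj G w) (Z ++ F)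
  degree = ≤-trans (h (here refl)) (≤-trans (m≤n+m _ _) (≤-reflexive (≡.sym (count-++ _ Z F))))

-- The exceptional set of a matching

module _ (G : Graph n) where

  bad : List (Fin n × Fin n) → List (Fin n)
  bad []            = []
  bad ((u , v) ∷ M) = nonNeighbours G u v ++ bad M

  length-bad : ∀ {c} → CoClosed c G → ∀ M → (∀ {u v} → (u , v) ∈ M → adj G u v ≡ true) →
               length (bad M) ≤ length M * pred c
  length-bad closed []            h = z≤n
  length-bad closed ((u , v) ∷ M) h = ≤-trans (≤-reflexive (length-++ (nonNeighbours G u v)))
    (+-mono-≤ (<⇒≤pred (length-nonNeighbours G closed (h (here refl)))) (length-bad closed M (h ∘ there)))

  ∉-bad : ∀ {M u v w} → (u , v) ∈ M → w ∉ flat M → w ∉ bad M → adj G w u ≡ true ⊎ adj G w v ≡ true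
  ∉-bad {(u , v) ∷ M} {w = w} (here refl) w∉M w∉b with adj G w u in wu | adj G w v in wv
  ... | true  | _     = inj₁ refl
  ... | false | true  = inj₂ refl
  ... | false | false = contradiction (∈-++⁺ˡ (∈-nonNeighbours G (trans (sym G u w) wu)
    (trans (sym G v w) wv) (λ { refl → w∉M (here refl) }) (λ { refl → w∉M (there (here refl)) }))) w∉b
  ∉-bad {(u , v) ∷ M} (there e∈) w∉M w∉b =
    ∉-bad e∈ (w∉M ∘ there ∘ there) (w∉b ∘ ∈-++⁺ʳ (nonNeighbours G u v))

  leftover? : ∀ S M → Decidable (λ x → x ∈ₛ S × x ∉ flat M × x ∉ bad M)
  leftover? S M x = x ∈ₛ? S ×-dec ¬? (x ∈? flat M) ×-dec ¬? (x ∈? bad M)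

  leftover : VSet n → List (Fin n × Fin n) → List (Fin n)
  leftover S M = filter (leftover? S M) (allFin n)

  ∈-leftover⁻ : ∀ {S M x} → x ∈ leftover S M → x ∈ₛ S × x ∉ flat M × x ∉ bad M
  ∈-leftover⁻ {S} {M} x∈ = proj₂ (∈-filter⁻ (leftover? S M) {xs = allFin n} x∈)

  unique-leftover : ∀ S M → Unique (leftover S M)
  unique-leftover S M = Unique.filter⁺ (leftover? S M) (Unique.allFin⁺ n)

  ∈-cover : ∀ {S} M {x} → x ∈ₛ S → x ∈ flat M ++ bad M ++ leftover S M
  ∈-cover {S} M {x} x∈ with x ∈? flat M | x ∈? bad M
  ... | yes x∈M | _       = ∈-++⁺ˡ x∈M
  ... | no _    | yes x∈b = ∈-++⁺ʳ (flat M) (∈-++⁺ˡ x∈b)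
  ... | no x∉M  | no x∉b  = ∈-++⁺ʳ (flat M) (∈-++⁺ʳ (bad M)
    (∈-filter⁺ (leftover? S M) (∈-allFin x) (x∈ , x∉M , x∉b)))

module _ {d : ℕ} {G : Graph n} {S : VSet n} (deg : Degenerate d G S)
         {M : List (Fin n × Fin n)} (mat : Matching G S M) where

  private
    m = length M
    Z = leftover G S M

  leftover-adjacent : ∀ {w u v} → w ∈ Z → (u , v) ∈ M → adj G w u ≡ true ⊎ adj G w v ≡ true
  leftover-adjacent w∈ e∈ = let _ , w∉M , w∉b = ∈-leftover⁻ G w∈ in ∉-bad G e∈ w∉M w∉b

  -- Edges inside `Z` together with V(M) are counted twice over: each vertex of `Z` sends at least
  -- one to every matching edge and `M` adds its own, while degeneracy allows d(|Z| + 2m - 1). The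
  -- summand `d` on the left avoids the subtraction.
  leftover-edges : ∀ {k} → length M ≡ k → 1 ≤ k → length Z * k + k + d ≤ d * (length Z + 2 * k)
  leftover-edges refl 1≤m = begin
    length Z * m + m + d                    ≤⟨ +-monoˡ-≤ d (+-monoʳ-≤ (length Z * m) (edgeCount-flat M (edge mat))) ⟩
    length Z * m + edgeCount G (flat M) + d ≤⟨ +-monoˡ-≤ d (edgeCount-join Z (flat M) λ w∈ →
                                                 count-flat-≥ _ M (leftover-adjacent w∈)) ⟩
    edgeCount G (Z ++ flat M) + d           ≤⟨ +-monoˡ-≤ d (edgeCount-≤ deg k length-l unique-l inS) ⟩
    d * k + d                               ≡⟨ +-comm (d * k) d ⟩
    d + d * k                               ≡⟨ *-suc d k ⟨
    d * suc k                               ≡⟨ cong (d *_) suc-k ⟩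
    d * (length Z + 2 * m)                  ∎
    where
    open ≤-Reasoning
    k = pred (length Z + 2 * m)
    suc-k : suc k ≡ length Z + 2 * m
    suc-k = suc-pred _ {{>-nonZero (≤-trans 1≤m (≤-trans (m≤n*m m 2) (m≤n+m (2 * m) (length Z))))}}
    length-l : length (Z ++ flat M) ≡ suc k
    length-l = trans (length-++ Z) (trans (cong (length Z +_) (length-flat M)) (≡.sym suc-k))
    unique-l : Unique (Z ++ flat M)
    unique-l = Unique.++⁺ (unique-leftover G S M) (unique mat)
      λ (x∈Z , x∈M) → proj₁ (proj₂ (∈-leftover⁻ G x∈Z)) x∈M
    inS : ∀ {x} → x ∈ Z ++ flat M → x ∈ₛ S
    inS x∈ = [ proj₁ ∘ ∈-leftover⁻ G , covered mat ]′ (∈-++⁻ Z x∈)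

  -- All of Z attaches to the same end of each matching edge, so more than d vertices in Z would
  -- give a K_{d+1,d+1}.
  leftover-maximum : NoMatching G S (suc m) → d < m → length Z ≤ d
  leftover-maximum none d<m = go Z refl
    where
    go : ∀ Z′ → Z ≡ Z′ → length Z ≤ d
    go []       eq = subst (λ l → length l ≤ d) (≡.sym eq) z≤n
    go (w₀ ∷ _) eq = ≮⇒≥ λ d<z →
      let v , v∈ , le = lowDegree deg (Z ++ A′) unique-l (w₀ , ∈-++⁺ˡ w₀∈) inS
      in <⇒≱ (high d<z v∈) le
      where
      w₀∈ : w₀ ∈ Z
      w₀∈ = subst (w₀ ∈_) (≡.sym eq) (here refl)
      -- The end of each matching edge to which `w₀` attaches; the other leftover vertices are shown
      -- to attach to the same end.
      hub : Fin n × Fin n → Fin n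
      hub (u , v) = if adj G w₀ u then u else v
      A′ = map hub M
      hub-adjacent : ∀ {w e} → w ∈ Z → e ∈ M → adj G w (hub e) ≡ true
      hub-adjacent {w} {u , v} w∈ e∈ with w ≟ w₀
      hub-adjacent {w} {u , v} w∈ e∈ | yes refl with adj G w₀ u in eq | leftover-adjacent w∈ e∈
      ... | true  | _       = eq
      ... | false | inj₂ wv = wv
      ... | false | inj₁ ()
      hub-adjacent {w} {u , v} w∈ e∈ | no w≢w₀
        with w∈S , w∉M , _ ← ∈-leftover⁻ G w∈ with w₀∈S , w₀∉M , _ ← ∈-leftover⁻ G w₀∈
        with adj G w₀ u in eq | leftover-adjacent w∈ e∈ | leftover-adjacent w₀∈ e∈
      ... | true  | inj₁ wu | _ = wu
      -- Otherwise `w₀`, `u`, `v`, `w` would be an augmenting path.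
      ... | true  | inj₂ wv | _ = ⊥-elim (no-augmenting mat none e∈ w₀∈S w∈S w₀∉M w∉M
                                    (w≢w₀ ∘ ≡.sym) (trans (sym G u w₀) eq) (trans (sym G v w) wv))
      ... | false | inj₂ wv | _ = wv
      ... | false | inj₁ wu | inj₂ w₀v = ⊥-elim (no-augmenting mat none e∈ w∈S w₀∈S w∉M w₀∉M
                                    w≢w₀ (trans (sym G u w) wu) (trans (sym G v w₀) w₀v))
      ... | false | inj₁ _  | inj₁ ()
      hub-∈ : ∀ M {x} → x ∈ map hub M → x ∈ flat M
      hub-∈ ((u , v) ∷ M) (here refl) with adj G w₀ u
      ... | true  = here refl
      ... | false = there (here refl)
      hub-∈ (_ ∷ M) (there x∈) = there (there (hub-∈ M x∈))
      unique-hubs : ∀ M → Unique (flat M) → Unique (map hub M)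
      unique-hubs [] _ = []
      unique-hubs ((u , v) ∷ M) uq@(_ ∷ uq′@(_ ∷ uq″)) with adj G w₀ u
      ... | true  = unique-cons (unique-head uq ∘ there ∘ hub-∈ M) (unique-hubs M uq″)
      ... | false = unique-cons (unique-head uq′ ∘ hub-∈ M) (unique-hubs M uq″)
      unique-l : Unique (Z ++ A′)
      unique-l = Unique.++⁺ (unique-leftover G S M) (unique-hubs M (unique mat))
        λ (x∈Z , x∈A) → proj₁ (proj₂ (∈-leftover⁻ G x∈Z)) (hub-∈ M x∈A)
      inS : ∀ {x} → x ∈ Z ++ A′ → x ∈ₛ S
      inS x∈ = [ proj₁ ∘ ∈-leftover⁻ G , covered mat ∘ hub-∈ M ]′ (∈-++⁻ Z x∈)
      -- Vertices of `Z` see all of the more than `d` hubs, and each hub sees all of the more than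
      -- `d` vertices of `Z`.
      high : d < length Z → ∀ {x} → x ∈ Z ++ A′ → d < countᵇ (adj G x) (Z ++ A′)
      high d<z {x} x∈ rewrite count-++ (adj G x) Z A′ with ∈-++⁻ Z x∈
      ... | inj₁ x∈Z = <-≤-trans d<m (≤-trans (≤-reflexive (≡.sym (trans (count-all (adj G x) A′ toA)
                         (length-map hub M)))) (m≤n+m _ _))
        where
        toA : ∀ {a} → a ∈ A′ → adj G x a ≡ true
        toA a∈ with e , e∈ , refl ← ∈-map⁻ hub a∈ = hub-adjacent x∈Z e∈
      ... | inj₂ x∈A with e , e∈ , refl ← ∈-map⁻ hub x∈A = <-≤-trans d<z (≤-trans (≤-reflexive
        (≡.sym (count-all (adj G x) Z λ {z} z∈ → trans (sym G _ z) (hub-adjacent z∈ e∈)))) (m≤m+n _ _))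

-- Sets with a small matching number

record Core (d : ℕ) (G : Graph n) (C : List (Fin n)) (S : VSet n) : Set where
  field
    core⊆       : ∀ {x} → x ∈ C → x ∈ₛ S
    lowCore     : ∀ {x} → x ∈ₛ S → x ∉ C → countᵇ (adj G x) C ≤ d
    outsideCore : ∀ {x y} → x ∈ₛ S → y ∈ₛ S → x ∉ C → y ∉ C → adj G x y ≡ false
open Core

module _ {G : Graph n} {S : VSet n} {M : List (Fin n × Fin n)} (mat : Matching G S M)
         (none : NoMatching G S (suc (length M))) where

  private
    Twin : Fin n × Fin n → Fin n → Set
    Twin (u , v) x = x ∈ₛ S × x ∉ flat M × adj G u x ≡ true × adj G v x ≡ true

    twin? : ∀ e → Decidable (Twin e)
    twin? (u , v) x =
      x ∈ₛ? S ×-dec ¬? (x ∈? flat M) ×-dec (adj G u x ≟ᵇ true) ×-dec (adj G v x ≟ᵇ true)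

    -- Two twins of the same matching edge would give an augmenting path, so one vertex per edge
    -- collects them all.
    twins : ∀ N → (∀ {e} → e ∈ N → e ∈ M) → ∃[ X ] length X ≤ length N ×
      (∀ {x} → x ∈ X → x ∈ₛ S × x ∉ flat M) × (∀ {e x} → e ∈ N → Twin e x → x ∈ X)
    twins []      _   = [] , z≤n , (λ ()) , λ ()
    twins (e@(u , v) ∷ N) N⊆M with twins N (N⊆M ∘ there) | any? (twin? e)
    ... | X , len , out , all-twins | no ¬t = X , m≤n⇒m≤1+n len , out ,
      λ { (here refl) t → contradiction (_ , t) ¬t ; (there e∈) t → all-twins e∈ t }
    ... | X , len , out , all-twins | yes (x , t@(x∈ , x∉ , ux , vx)) = x ∷ X , s≤s len ,
      (λ { (here refl) → x∈ , x∉ ; (there y∈) → out y∈ }) ,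
      λ { (here refl) t′ → here (only t′) ; (there e∈) t′ → there (all-twins e∈ t′) }
      where
      only : ∀ {y} → Twin e y → y ≡ x
      only {y} (y∈ , y∉ , uy , vy) = decidable-stable (y ≟ x) λ y≢x →
        no-augmenting mat none (N⊆M (here refl)) y∈ x∈ y∉ x∉ y≢x uy vx

  -- The core is V(M) together with the twins, at most 2m + m vertices. Any other vertex of `S` sees
  -- at most one end of each matching edge and no twin, hence at most m core vertices.
  matching-core : ∀ {d} → length M ≤ d → ∃[ C ] length C ≤ 3 * d × Core d G C S
  matching-core {d} m≤d with X , len , out , all-twins ← twins M id = flat M ++ X , length-C , record
    { core⊆       = λ x∈ → [ covered mat , proj₁ ∘ out ]′ (∈-++⁻ (flat M) x∈)
    ; lowCore     = low
    ; outsideCore = λ x∈ y∈ x∉ y∉ →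
        outside-independent mat none x∈ y∈ (x∉ ∘ ∈-++⁺ˡ) (y∉ ∘ ∈-++⁺ˡ)
    }
    where
    open ≤-Reasoning
    length-C : length (flat M ++ X) ≤ 3 * d
    length-C = begin
      length (flat M ++ X)      ≡⟨ trans (length-++ (flat M)) (cong (_+ length X) (length-flat M)) ⟩
      2 * length M + length X   ≤⟨ +-monoʳ-≤ (2 * length M) len ⟩
      2 * length M + length M   ≡⟨ +-comm (2 * length M) (length M) ⟩
      3 * length M              ≤⟨ *-monoʳ-≤ 3 m≤d ⟩
      3 * d                     ∎
    low : ∀ {x} → x ∈ₛ S → x ∉ flat M ++ X → countᵇ (adj G x) (flat M ++ X) ≤ d
    low {x} x∈ x∉ = begin
      countᵇ (adj G x) (flat M ++ X)                   ≡⟨ count-++ (adj G x) (flat M) X ⟩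
      countᵇ (adj G x) (flat M) + countᵇ (adj G x) X   ≡⟨ cong (countᵇ (adj G x) (flat M) +_) none-X ⟩
      countᵇ (adj G x) (flat M) + 0                    ≡⟨ +-identityʳ _ ⟩
      countᵇ (adj G x) (flat M)                        ≤⟨ count-flat-≤ (adj G x) M not-both ⟩
      length M                                         ≤⟨ m≤d ⟩
      d                                                ∎
      where
      none-X : countᵇ (adj G x) X ≡ 0
      none-X = count-none (adj G x) X λ y∈ → let y∈S , y∉M = out y∈ in
        outside-independent mat none x∈ y∈S (x∉ ∘ ∈-++⁺ˡ) y∉M
      not-both : ∀ {u v} → (u , v) ∈ M → adj G x u ≡ true → adj G x v ≡ true → ⊥
      not-both {u} {v} e∈ xu xv = x∉ (∈-++⁺ʳ (flat M) (all-twins e∈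
        (x∈ , x∉ ∘ ∈-++⁺ˡ , trans (sym G u x) xu , trans (sym G v x) xv)))

module _ {d : ℕ} {G : Graph n} (C : List (Fin n)) where

  -- The condition refers to `C` alone, so all sets with core `C` give maximal independent sets of
  -- one and the same vertex set.
  Eligible : Fin n → Set
  Eligible x = x ∉ C × countᵇ (adj G x) C ≤ d

  eligible? : Decidable Eligible
  eligible? x = ¬? (x ∈? C) ×-dec (countᵇ (adj G x) C ≤? d)

  outer? : (S : VSet n) → Decidable (λ x → x ∈ₛ S × x ∉ C)
  outer? S x = x ∈ₛ? S ×-dec ¬? (x ∈? C)

  outer : VSet n → VSet n
  outer S = fromDec (outer? S)

  -- Vertices outside the core only see the core, where they have low degree, so they can be peeled
  -- off first; hence S could be extended by any eligible vertex independent of them.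
  outer-MIS : ∀ {S} → MaximalIn d G (allFin n) S → Core d G C S → MIS G Eligible (outer S)
  outer-MIS {S} max core = record
    { within      = λ x∈ → let x∈S , x∉C = ∈-fromDec⁻ (outer? S) x∈ in x∉C , lowCore core x∈S x∉C
    ; independent = λ x∈ y∈ → let x∈S , x∉C = ∈-fromDec⁻ (outer? S) x∈
                                  y∈S , y∉C = ∈-fromDec⁻ (outer? S) y∈
                              in outsideCore core x∈S y∈S x∉C y∉C
    ; dominating  = dom
    }
    where
    dom : ∀ {x} → Eligible x → x ∉ₛ outer S → ∃[ y ] y ∈ₛ outer S × adj G x y ≡ true
    dom {x} (x∉C , low) x∉ with any? (λ y → y ∈ₛ? outer S ×-dec (adj G x y ≟ᵇ true))
    ... | yes found = found
    ... | no ¬found = ⊥-elim (maximal max (∈-allFin x)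
                        (λ x∈S → x∉ (∈-fromDec⁺ (outer? S) (x∈S , x∉C))) extended)
      where
      x-free : ∀ {y} → y ∈ₛ S → y ∉ C → adj G x y ≡ false
      x-free y∈ y∉ = ¬-not λ xy → ¬found (_ , ∈-fromDec⁺ (outer? S) (y∈ , y∉) , xy)
      outer-independent : ∀ {y z} → y ∈ₛ insert x S → z ∈ₛ insert x S → y ∉ C → z ∉ C → adj G y z ≡ false
      outer-independent {y} {z} y∈ z∈ y∉ z∉ with y ≟ x | z ≟ x
      ... | yes refl | yes refl = irrefl G x
      ... | yes refl | no z≢x   = x-free (∈-insert⁻ S z∈ z≢x) z∉
      ... | no y≢x   | yes refl = trans (sym G y x) (x-free (∈-insert⁻ S y∈ y≢x) y∉)
      ... | no y≢x   | no z≢x   = outsideCore core (∈-insert⁻ S y∈ y≢x) (∈-insert⁻ S z∈ z≢x) y∉ z∉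
      low-outside : ∀ {y} → y ∈ₛ insert x S → y ∉ C → countᵇ (adj G y) C ≤ d
      low-outside {y} y∈ y∉ with y ≟ x
      ... | yes refl = low
      ... | no y≢x   = lowCore core (∈-insert⁻ S y∈ y≢x) y∉
      extended : Degenerate d G (insert x S)
      -- A listed vertex outside `C` has all its listed neighbours in `C`, at most `d` of them; if
      -- there is none, the list lies in `S`.
      extended .lowDegree l u ne sub with Any.any? (λ y → ¬? (y ∈? C)) l
      ... | yes p with y , y∈ , y∉ ← find p = y , y∈ , ≤-trans
        (count-≤ _ _ u λ {z} z∈ yz → decidable-stable (z ∈? C)
          (λ z∉ → true≢false yz (outer-independent (sub y∈) (sub z∈) y∉ z∉)) , yz)
        (low-outside (sub y∈) y∉)
      ... | no ¬p = lowDegree (degenerate max) l u ne λ {y} y∈ →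
        core⊆ core (decidable-stable (y ∈? C) λ y∉ → ¬p (lose y∈ y∉))

  -- Since `C` is contained in every set with core `C`, such a set is `C` together with its outer
  -- part.
  outer-injective : ∀ {S T} → Core d G C S → Core d G C T → outer S ≡ outer T → S ≡ T
  outer-injective cS cT eq = VSet-ext (down cT eq) (down cS (≡.sym eq))
    where
    down : ∀ {S T} → Core d G C T → outer S ≡ outer T → ∀ {x} → x ∈ₛ S → x ∈ₛ T
    down {S} {T} cT eq {x} x∈ with x ∈? C
    ... | yes x∈C = core⊆ cT x∈C
    ... | no x∉C  = proj₁ (∈-fromDec⁻ (outer? T) (subst (x ∈ₛ_) eq (∈-fromDec⁺ (outer? S) (x∈ , x∉C))))

length-wordsUpTo-Fin : ∀ n k → length (wordsUpTo (allFin n) k) ≤ suc n ^ k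
length-wordsUpTo-Fin n k = ≤-trans (length-wordsUpTo (allFin n) k)
  (≤-reflexive (cong (λ j → suc j ^ k) (length-allFin n)))

Cored : ℕ → Graph n → VSet n → Set
Cored d G S = ∃[ C ] length C ≤ 3 * d × Core d G C S

bounded-cored : ∀ {d c D} {G : Graph n} → CoClosed c G →
  (∀ {Q} → length Q < c → Bounded (MIS G (_∈ Q)) D) →
  Bounded (λ S → MaximalIn d G (allFin n) S × Cored d G S) (suc n ^ (3 * d) * (1 + n * (n * D)))
bounded-cored {n} {d} {G = G} closed small =
  bounded-≤ (*-monoˡ-≤ _ (length-wordsUpTo-Fin n (3 * d)))
  (bounded-⊆ (λ (max , C , len , core) → C , ∈-wordsUpTo C len (λ _ → ∈-allFin _) , max , core)
    (bounded-∃ (wordsUpTo (allFin n) (3 * d)) λ C → bounded-injection (outer {d = d} {G} C)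
      (λ (max , core) → outer-MIS C max core) (λ (_ , cS) (_ , cT) → outer-injective C cS cT)
      (bounded-MIS (eligible? {d = d} {G} C) closed small)))

-- Sets with a large matching number

Covered : ℕ → ℕ → Graph n → VSet n → Set
Covered m z G S = ∃[ M ] ∃[ Z ] (length M ≤ m × length Z ≤ z ×
  (∀ {u v} → (u , v) ∈ M → adj G u v ≡ true)) × (∀ {x} → x ∈ₛ S → x ∈ flat M ++ bad G M ++ Z)

covered-leftover : ∀ {m z} {G : Graph n} {S M} → Matching G S M → length M ≤ m →
                   length (leftover G S M) ≤ z → Covered m z G S
covered-leftover {G = G} {S} {M} mat m≤ z≤ = M , leftover G S M , (m≤ , z≤ , edge mat) , ∈-cover G M

-- The code of `S` is the pair `M`, `Z`, naming at most 2m + z vertices. It determines `U`, made of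
-- V(M), the exceptional vertices and `Z`, and `S` is a maximal set of `U`.
bounded-covered : ∀ {d c m z b} {G : Graph n} → CoClosed c G →
  (∀ {U} → length U ≤ 2 * m + (m * pred c + z) → Bounded (MaximalIn d G U) b) →
  Bounded (λ S → MaximalIn d G (allFin n) S × Covered m z G S) (suc n ^ (2 * m + z) * b)
bounded-covered {n} {d} {c} {m} {z} {b} {G} closed small = bounded-≤ codes
  (bounded-⊆ (λ (max , M , Z , (lenM , lenZ , edges) , S⊆) →
      M , ∈-wordsUpTo M lenM (λ _ → ∈-pairs _) , Z , ∈-wordsUpTo Z lenZ (λ _ → ∈-allFin _) ,
      (lenM , lenZ , edges) , maximalIn-restrict (λ _ → ∈-allFin _) S⊆ max)
    (bounded-∃ (wordsUpTo (pairs n) m) λ M → bounded-∃ (wordsUpTo (allFin n) z) λ Z →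
      bounded-guard (small ∘ length-U M Z)))
  where
  open ≤-Reasoning
  length-U : ∀ M Z → length M ≤ m × length Z ≤ z × (∀ {u v} → (u , v) ∈ M → adj G u v ≡ true) →
             length (flat M ++ bad G M ++ Z) ≤ 2 * m + (m * pred c + z)
  length-U M Z (lenM , lenZ , edges) = begin
    length (flat M ++ bad G M ++ Z)                 ≡⟨ length-++ (flat M) ⟩
    length (flat M) + length (bad G M ++ Z)         ≡⟨ cong₂ _+_ (length-flat M) (length-++ (bad G M)) ⟩
    2 * length M + (length (bad G M) + length Z)    ≤⟨ +-mono-≤ (*-monoʳ-≤ 2 lenM)
      (+-mono-≤ (≤-trans (length-bad G closed M edges) (*-monoˡ-≤ (pred c) lenM)) lenZ) ⟩
    2 * m + (m * pred c + z)                        ∎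
  square : suc (length (pairs n)) ≤ suc n ^ 2
  square = begin
    suc (length (pairs n))   ≡⟨ cong suc (trans (length-cartesianProductWith _,_ (allFin n) (allFin n))
                                  (cong₂ _*_ (length-allFin n) (length-allFin n))) ⟩
    suc (n * n)              ≤⟨ s≤s (≤-trans (m≤n+m (n * n) (n + n)) (≤-reflexive (identity n))) ⟩
    suc n ^ 2                ∎
    where
    identity : ∀ n → n + n + n * n ≡ n * 1 + n * suc (n * 1)
    identity = solve-∀
  codes : length (wordsUpTo (pairs n) m) * (length (wordsUpTo (allFin n) z) * b) ≤ suc n ^ (2 * m + z) * b
  codes = begin
    length (wordsUpTo (pairs n) m) * (length (wordsUpTo (allFin n) z) * b)
      ≤⟨ *-mono-≤ (≤-trans (length-wordsUpTo (pairs n) m) (^-monoˡ-≤ m square))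
           (*-monoˡ-≤ b (length-wordsUpTo-Fin n z)) ⟩
    (suc n ^ 2) ^ m * (suc n ^ z * b)   ≡⟨ cong (_* (suc n ^ z * b)) (^-*-assoc (suc n) 2 m) ⟩
    suc n ^ (2 * m) * (suc n ^ z * b)   ≡⟨ *-assoc (suc n ^ (2 * m)) (suc n ^ z) b ⟨
    suc n ^ (2 * m) * suc n ^ z * b     ≡⟨ cong (_* b) (^-distribˡ-+-* (suc n) (2 * m) z) ⟨
    suc n ^ (2 * m + z) * b             ∎

-- Either `S` fills `U`, which accounts for the 1, or it misses some `r` in `U` and is maximal in
-- `U` without `r`.
bounded-shrink : ∀ {d N b} {G : Graph n} →
  (∀ {U} → length U ≤ N → Bounded (MaximalIn d G U) b) →
  ∀ {U} → length U ≤ suc N → Bounded (MaximalIn d G U) (1 + suc N * b)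
bounded-shrink {n} {d} {N} {b} {G} small {U} len = bounded-≤ (s≤s (*-monoˡ-≤ b len))
  (bounded-⊆ split (bounded-⊎ (bounded-subsingleton full-unique) (bounded-∃ U λ r → bounded-guard (small ∘ shorter))))
  where
  Full : VSet n → Set
  Full S = (∀ {x} → x ∈ₛ S → x ∈ U) × (∀ {x} → x ∈ U → x ∈ₛ S)
  full-unique : ∀ {S T} → Full S → Full T → S ≡ T
  full-unique (SU , US) (TU , UT) = VSet-ext (UT ∘ SU) (US ∘ TU)
  without : Fin n → List (Fin n)
  without r = filter (λ x → ¬? (x ≟ r)) U
  shorter : ∀ {r} → r ∈ U → length (without r) ≤ N
  shorter {r} r∈ = ≤-pred (≤-trans (filter-notAll (λ x → ¬? (x ≟ r)) U
    (Any.map (λ { refl r≢ → r≢ refl }) r∈)) len)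
  -- Membership of `r` appears twice: once as the index of the union bound, once as the guard that
  -- makes the list shorter.
  split : ∀ {S} → MaximalIn d G U S → Full S ⊎ ∃[ r ] r ∈ U × r ∈ U × MaximalIn d G (without r) S
  split {S} max with Any.any? (λ x → ¬? (x ∈ₛ? S)) U
  ... | no ¬p = inj₁ (inside max , λ {x} x∈ → decidable-stable (x ∈ₛ? S) λ x∉ → ¬p (lose x∈ x∉))
  ... | yes p with r , r∈ , r∉ ← find p = inj₂ (r , r∈ , r∈ , maximalIn-restrict
    (proj₁ ∘ ∈-filter⁻ (λ x → ¬? (x ≟ r)))
    (λ x∈ → ∈-filter⁺ (λ x → ¬? (x ≟ r)) (inside max x∈) λ { refl → r∉ x∈ }) max)

-- Bounds in terms of D and the constants

module _ {d c n D : ℕ} (1≤d : 1 ≤ d) (1≤n : 1 ≤ n) (G : Graph n) (closed : CoClosed c G)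
         (dmax : IsDmax d (2 * d * c) D) where

  open ≤-Reasoning

  bounded-by-D : ∀ {U} → length U ≤ 2 * d * c → Bounded (MaximalIn d G U) D
  bounded-by-D len = let H , h = bounded-in-small len in bounded-≤ (proj₂ dmax H) h

  -- The empty set is maximal in the empty ambient list. Positivity lets additive constants be
  -- absorbed into multiples of `D`.
  D-positive : 1 ≤ D
  D-positive = bounded-by-D {[]} z≤n (∅ ∷ []) ([] ∷ []) (∅-maximal ∷ [])
    where
    none? : Decidable {A = Fin n} (λ _ → ⊥)
    none? _ = no id
    ∅ = fromDec none?
    ∅-maximal : MaximalIn d G [] ∅
    ∅-maximal = record
      { inside     = ⊥-elim ∘ ∈-fromDec⁻ none?
      ; degenerate = degen λ l u (x , x∈) sub → ⊥-elim (∈-fromDec⁻ none? (sub x∈))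
      ; maximal    = λ ()
      }

  bounded-MIS-by-D : ∀ {Q} → length Q < c → Bounded (MIS G (_∈ Q)) D
  bounded-MIS-by-D {Q} len = let H , h = bounded-MIS-small le in bounded-≤ (proj₂ dmax H) h
    where
    le : length Q * suc d ≤ 2 * d * c
    le = begin
      -- Here d + 1 is at most 2d because d is at least 1.
      length Q * suc d ≤⟨ *-mono-≤ (<⇒≤ len) (+-mono-≤ 1≤d (≤-reflexive (≡.sym (+-identityʳ d)))) ⟩
      c * (2 * d)      ≡⟨ *-comm c (2 * d) ⟩
      2 * d * c        ∎

  bounded-cored-by-D : Bounded (λ S → MaximalIn d G (allFin n) S × Cored d G S) (suc n ^ (8 * d) * D)
  bounded-cored-by-D = bounded-≤ le (bounded-cored closed bounded-MIS-by-D)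
    where
    identity : ∀ n D → n * (n * D) + (n + n) * D + D ≡ suc n * (suc n * 1) * D
    identity = solve-∀
    exponents : ∀ d → 3 * d + 5 * d ≡ 8 * d
    exponents = solve-∀
    quadratic : 1 + n * (n * D) ≤ suc n ^ 2 * D
    quadratic = begin
      1 + n * (n * D)                   ≤⟨ +-monoˡ-≤ _ D-positive ⟩
      D + n * (n * D)                   ≡⟨ +-comm D _ ⟩
      n * (n * D) + D                   ≤⟨ +-monoˡ-≤ D (m≤m+n _ _) ⟩
      n * (n * D) + (n + n) * D + D     ≡⟨ identity n D ⟩
      suc n ^ 2 * D                     ∎
    le : suc n ^ (3 * d) * (1 + n * (n * D)) ≤ suc n ^ (8 * d) * D
    le = begin
      suc n ^ (3 * d) * (1 + n * (n * D))   ≤⟨ *-monoʳ-≤ (suc n ^ (3 * d)) quadratic ⟩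
      suc n ^ (3 * d) * (suc n ^ 2 * D)     ≡⟨ *-assoc (suc n ^ (3 * d)) (suc n ^ 2) D ⟨
      suc n ^ (3 * d) * suc n ^ 2 * D       ≡⟨ cong (_* D) (^-distribˡ-+-* (suc n) (3 * d) 2) ⟨
      -- The core costs 3d vertices and the anchor 2, and 2 is at most 5d.
      suc n ^ (3 * d + 2) * D               ≤⟨ *-monoˡ-≤ D (^-monoʳ-≤ (suc n)
        (+-monoʳ-≤ (3 * d) (≤-trans (s≤s (s≤s z≤n)) (*-monoʳ-≤ 5 1≤d)))) ⟩
      suc n ^ (3 * d + 5 * d) * D           ≡⟨ cong (λ k → suc n ^ k * D) (exponents d) ⟩
      suc n ^ (8 * d) * D                   ∎

  suc-power : ∀ k → suc n ^ k ≤ 2 ^ k * n ^ k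
  suc-power zero    = ≤-refl
  suc-power (suc k) = begin
    suc n * suc n ^ k           ≤⟨ *-mono-≤ (+-monoˡ-≤ n 1≤n) (suc-power k) ⟩
    (n + n) * (2 ^ k * n ^ k)   ≡⟨ identity n (2 ^ k) (n ^ k) ⟩
    2 * 2 ^ k * (n * n ^ k)     ∎
    where
    identity : ∀ n x y → (n + n) * (x * y) ≡ 2 * x * (n * y)
    identity = solve-∀

  -- The covered sets contribute `k` and the cored sets 1 to the factor `suc k`; replacing n + 1 by
  -- 2n costs `2 ^ (8 * d)`.
  numMax-≤ : ∀ {k m z} →
    (∀ {S} → MaximalIn d G (allFin n) S → Covered m z G S ⊎ Cored d G S) →
    Bounded (λ S → MaximalIn d G (allFin n) S × Covered m z G S) (k * (suc n ^ (8 * d) * D)) →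
    numMaxDegenerate d G ≤ suc k * 2 ^ (8 * d) * n ^ (8 * d) * D
  numMax-≤ {k} classify h = begin
    numMaxDegenerate d G                      ≤⟨ numMax-bounded (bounded-⊆
      (λ max → Sum.map (max ,_) (max ,_) (classify max)) (bounded-⊎ h bounded-cored-by-D)) ⟩
    k * (suc n ^ p * D) + suc n ^ p * D       ≡⟨ +-comm _ (suc n ^ p * D) ⟩
    suc k * (suc n ^ p * D)                   ≤⟨ *-monoʳ-≤ (suc k) (*-monoˡ-≤ D (suc-power p)) ⟩
    suc k * (2 ^ p * n ^ p * D)               ≡⟨ identity (suc k) (2 ^ p) (n ^ p) D ⟩
    suc k * 2 ^ p * n ^ p * D                 ∎
    where
    p = 8 * d
    identity : ∀ a b c d → a * (b * c * d) ≡ a * b * c * d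
    identity = solve-∀

-- If n is at most 2c, the whole graph is a small ambient set. Otherwise 28 is 27 + 1, where 27 is
-- the cube of the factor 3 from three shrinking steps; the 5 described vertices and these 3 steps
-- give exponent 8.
numMax-1 : ∀ {c n D} → 1 ≤ c → 1 ≤ n → (G : Graph n) → CoClosed c G → IsDmax 1 (2 * 1 * c) D →
           numMaxDegenerate 1 G ≤ 28 * 2 ^ 8 * n ^ 8 * D
numMax-1 {suc q} {n} {D} _ 1≤n G closed dmax with n ≤? 2 * 1 * suc q
... | yes n≤ = begin
  numMaxDegenerate 1 G     ≤⟨ numMax-bounded (bounded-by-D ≤-refl 1≤n G closed dmax
                                (≤-trans (≤-reflexive (length-allFin n)) n≤)) ⟩
  D                        ≡⟨ *-identityˡ D ⟨
  1 * D                    ≤⟨ *-monoˡ-≤ D (*-mono-≤ {1} {28 * 2 ^ 8} (s≤s z≤n)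
                                (m^n>0 n {{>-nonZero 1≤n}} 8)) ⟩
  28 * 2 ^ 8 * n ^ 8 * D   ∎
  where open ≤-Reasoning
... | no n≰ = numMax-≤ ≤-refl 1≤n G closed dmax {k = 27} {2} {1} classify
    (bounded-≤ (≤-reflexive (identity (suc n) D)) (bounded-covered closed large))
  where
  open ≤-Reasoning
  classify : ∀ {S} → MaximalIn 1 G (allFin n) S → Covered 2 1 G S ⊎ Cored 1 G S
  classify {S} max with matching-up-to G S 2
  ... | inj₂ (M , mat , s≤s m≤1 , none) = inj₂ (matching-core mat none m≤1)
  ... | inj₁ (M , mat , len) = inj₁ (covered-leftover mat (≤-reflexive len)
    (bound _ (leftover-edges (degenerate max) mat len (s≤s z≤n))))
    where
    -- For d = 1 and two edges the count reads 2z + 3 ≤ z + 4.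
    bound : ∀ z → z * 2 + 2 + 1 ≤ 1 * (z + 2 * 2) → z ≤ 1
    bound zero          _ = z≤n
    bound (suc zero)    _ = s≤s z≤n
    bound (suc (suc z)) h = contradiction h (<⇒≱ (≤-trans (m≤m+n _ z) (≤-reflexive (slack z))))
      where
      slack : ∀ z → suc (1 * (suc (suc z) + 2 * 2)) + z ≡ suc (suc z) * 2 + 2 + 1
      slack = solve-∀
  N = 2 * 1 * suc q
  step : ∀ {k b} → suc k ≤ 2 + n → 1 ≤ b → 1 + suc k * b ≤ 3 * suc n * b
  step {k} {b} k≤ 1≤b = begin
    1 + suc k * b         ≤⟨ +-mono-≤ 1≤b (*-monoˡ-≤ b k≤) ⟩
    b + (2 + n) * b       ≤⟨ m≤m+n _ ((n + n) * b) ⟩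
    b + (2 + n) * b + (n + n) * b ≡⟨ tripled n b ⟩
    3 * suc n * b         ∎
    where
    tripled : ∀ n b → b + (2 + n) * b + (n + n) * b ≡ 3 * suc n * b
    tripled = solve-∀
  positive : ∀ {b} → 1 ≤ b → 1 ≤ 3 * suc n * b
  positive 1≤b = *-mono-≤ {1} {3 * suc n} (s≤s z≤n) 1≤b
  1≤D = D-positive ≤-refl 1≤n G closed dmax
  shrink : ∀ {k b} → suc k ≤ 2 + n → 1 ≤ b →
    (∀ {U} → length U ≤ k → Bounded (MaximalIn 1 G U) b) →
    ∀ {U} → length U ≤ suc k → Bounded (MaximalIn 1 G U) (3 * suc n * b)
  shrink k≤ 1≤b h len = bounded-≤ (step k≤ 1≤b) (bounded-shrink h len)
  a = 3 * suc n
  large : ∀ {U} → length U ≤ 2 * 2 + (2 * pred (suc q) + 1) → Bounded (MaximalIn 1 G U) (a * (a * (a * D)))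
  -- From 2c + 3 down to 2c vertices; 2c < n keeps every intermediate size at most n + 2.
  large len = shrink {2 + N} (s≤s (s≤s (≰⇒> n≰))) (positive (positive 1≤D))
    (shrink {1 + N} (s≤s (m≤n⇒m≤1+n (≰⇒> n≰))) (positive 1≤D)
      (shrink {N} (m≤n⇒m≤1+n (m≤n⇒m≤1+n (≰⇒> n≰))) 1≤D (bounded-by-D ≤-refl 1≤n G closed dmax)))
    (≤-trans len (≤-reflexive (size q)))
    where
    size : ∀ q → 2 * 2 + (2 * q + 1) ≡ suc (suc (suc (2 * 1 * suc q)))
    size = solve-∀
  identity : ∀ a D → a ^ 5 * (3 * a * (3 * a * (3 * a * D))) ≡ 27 * (a ^ 8 * D)
  identity = unfolded
    where
    unfolded : ∀ a D → a * (a * (a * (a * (a * 1)))) * (3 * a * (3 * a * (3 * a * D))) ≡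
                       27 * (a * (a * (a * (a * (a * (a * (a * (a * 1))))))) * D)
    unfolded = solve-∀

module _ (e : ℕ) where

  private
    d t E : ℕ
    d = suc (suc e)
    t = suc (2 * suc e)
    E = 2 * d * (6 * d)

  -- t = 2d - 1 is the largest matching size for which the exceptional set, of size about tc, stays
  -- below 2dc for large c.
  numMax-≥2 : ∀ {c n D} → 1 ≤ c → 1 ≤ n → (G : Graph n) → CoClosed c G → IsDmax d (2 * d * c) D →
              numMaxDegenerate d G ≤ suc (2 ^ E) * 2 ^ (8 * d) * n ^ (8 * d) * D
  numMax-≥2 {suc q} {n} {D} _ 1≤n G closed dmax =
    numMax-≤ (s≤s z≤n) 1≤n G closed dmax {k = 2 ^ E} {t} {4 * d + 1} classify
      (bounded-≤ powers (bounded-covered closed large))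
    where
    open ≤-Reasoning
    suc-t : suc t ≡ 2 * d
    suc-t = identity e
      where
      identity : ∀ e → suc (suc (2 * suc e)) ≡ 2 * suc (suc e)
      identity = solve-∀

    bound : ∀ {z} → z * t + t + d ≤ d * (z + 2 * t) → z ≤ 4 * d + 1
    -- With t = 2d - 1 the hypothesis amounts to z(d - 1) ≤ (4d - 1)(d - 1). The weaker bound 4d + 1
    -- still keeps the description at 2t + 4d + 1 = 8d - 1 vertices.
    bound {z} h = ≮⇒≥ λ z> → let y , eq = m≤n⇒∃[o]m+o≡n z> in
      <⇒≱ (≤-trans (m≤m+n _ _) (≤-reflexive (slack e y)))
        (subst (λ z → z * t + t + d ≤ d * (z + 2 * t)) (≡.sym eq) h)
      where
      slack : ∀ e y →
        suc (suc (suc e) * (suc (4 * suc (suc e) + 1) + y + 2 * suc (2 * suc e))) + (y * suc e + (3 * e + 2)) ≡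
        (suc (4 * suc (suc e) + 1) + y) * suc (2 * suc e) + suc (2 * suc e) + suc (suc e)
      slack = solve-∀

    classify : ∀ {S} → MaximalIn d G (allFin n) S → Covered t (4 * d + 1) G S ⊎ Cored d G S
    classify {S} max with matching-up-to G S t
    ... | inj₁ (M , mat , len) = inj₁ (covered-leftover mat (≤-reflexive len)
      (bound (leftover-edges (degenerate max) mat len (s≤s z≤n))))
    ... | inj₂ (M , mat , m<t , none) with length M ≤? d
    ...   | yes m≤d = inj₂ (matching-core mat none m≤d)
    ...   | no m≰d  = inj₁ (covered-leftover mat (<⇒≤ m<t)
      (≤-trans (leftover-maximum (degenerate max) mat none (≰⇒> m≰d))
               (≤-trans (m≤n*m d 4) (m≤m+n (4 * d) 1))))

    1≤D = D-positive (s≤s z≤n) 1≤n G closed dmax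

    size : ∀ e q → 2 * suc (2 * suc e) + (suc (2 * suc e) * q + (4 * suc (suc e) + 1)) ≡
                   suc (2 * suc e) * suc q + 6 * suc (suc e)
    size = solve-∀

    -- The size is at most tc + 6d. For c ≥ 6d this is at most (t + 1)c = 2dc; otherwise it is at
    -- most the constant `E`, and the at most 2^E sets enter the constant factor.
    large : ∀ {U} → length U ≤ 2 * t + (t * pred (suc q) + (4 * d + 1)) → Bounded (MaximalIn d G U) (2 ^ E * D)
    large {U} len with 6 * d ≤? suc q
    ... | yes 6d≤c = bounded-≤ (m≤n*m D (2 ^ E) {{>-nonZero (m^n>0 2 E)}})
      (bounded-by-D (s≤s z≤n) 1≤n G closed dmax (begin
        length U              ≤⟨ len ⟩
        _                     ≡⟨ size e q ⟩
        t * suc q + 6 * d     ≤⟨ +-monoʳ-≤ (t * suc q) 6d≤c ⟩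
        t * suc q + suc q     ≡⟨ +-comm (t * suc q) (suc q) ⟩
        suc t * suc q         ≡⟨ cong (_* suc q) suc-t ⟩
        2 * d * suc q         ∎))
    ... | no c<6d =
      let H , h = bounded-in-small {N = E} (begin
            length U              ≤⟨ len ⟩
            _                     ≡⟨ size e q ⟩
            t * suc q + 6 * d     ≤⟨ +-monoˡ-≤ (6 * d) (*-monoʳ-≤ t (<⇒≤ (≰⇒> c<6d))) ⟩
            t * (6 * d) + 6 * d   ≡⟨ +-comm (t * (6 * d)) (6 * d) ⟩
            suc t * (6 * d)       ≡⟨ cong (_* (6 * d)) suc-t ⟩
            E                     ∎)
      in bounded-≤ (≤-trans (count-bounded (isMaxDegenerate d H) (bounded-VSet _)) (m≤m*n (2 ^ E) D {{>-nonZero 1≤D}})) h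

    powers : suc n ^ (2 * t + (4 * d + 1)) * (2 ^ E * D) ≤ 2 ^ E * (suc n ^ (8 * d) * D)
    powers = begin
      suc n ^ (2 * t + (4 * d + 1)) * (2 ^ E * D) ≤⟨ *-monoˡ-≤ _ (^-monoʳ-≤ (suc n) exponents) ⟩
      suc n ^ (8 * d) * (2 ^ E * D)               ≡⟨ *-assoc (suc n ^ (8 * d)) (2 ^ E) D ⟨
      suc n ^ (8 * d) * 2 ^ E * D                 ≡⟨ cong (_* D) (*-comm (suc n ^ (8 * d)) (2 ^ E)) ⟩
      2 ^ E * suc n ^ (8 * d) * D                 ≡⟨ *-assoc (2 ^ E) (suc n ^ (8 * d)) D ⟩
      2 ^ E * (suc n ^ (8 * d) * D)               ∎
      where
      identity : ∀ e → 2 * suc (2 * suc e) + (4 * suc (suc e) + 1) + 1 ≡ 8 * suc (suc e)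
      identity = solve-∀
      exponents : 2 * t + (4 * d + 1) ≤ 8 * d
      exponents = ≤-trans (m≤m+n _ 1) (≤-reflexive (identity e))

theorem22 : (d : ℕ) → 1 ≤ d →
    ∃[ K ] ∃[ N₀ ] ∀ (c n : ℕ) → 1 ≤ c → N₀ ≤ n →
    (G : Graph n) → CoClosed c G →
    (D : ℕ) → IsDmax d (2 * d * c) D →
    numMaxDegenerate d G ≤ K * n ^ (8 * d) * D
-- The case d = 1 is separate: with t = 2d - 1 = 1 the edge count gives no bound on the leftover
-- vertices, as the factor d - 1 vanishes.
theorem22 (suc zero) _ = 28 * 2 ^ 8 , 1 , λ c n 1≤c 1≤n G closed D → numMax-1 1≤c 1≤n G closed
theorem22 (suc (suc e)) _ =
  suc (2 ^ (2 * d * (6 * d))) * 2 ^ (8 * d) , 1 , λ c n 1≤c 1≤n G closed D → numMax-≥2 e 1≤c 1≤n G closed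
  where d = suc (suc e)
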